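{- (Local Fan Inequality.) Let $k\ge 2$, let $G=(V,E,\iota)$ be a finite multi-graph with maximum degree at most $k$, and let $\phi$ be a proper local partial colouring of $G$ with colours in $[k]$ that admits no improving Vizing chain. Let $e\in E$ be uncoloured by $\phi$, let $x\in e$, and let $F=(e_1,y_1,\dots,e_p,y_p)$ be a multi-fan at $x$ with respect to $e$ and $\phi$. Then: (a) For every $i\in[p]$ there exist $m\ge0$ and indices $i_0>i_1>\dots>i_m$ with $i_0=i$, $i_m=1$, such that $(e_{i_m},e_{i_{m-1}},\dots,e_{i_0})$ is a $\phi$-safe $\phi$-chain. (b) For every $i\in[p]$, $A_\phi(x)\cap A_\phi(y_i)\cap[\max\{d(x)+\pi(x),\,d(y_i)+\pi(y_i)\}]=\emptyset$. (c) For all $i\in[p]$, $\alpha\in\tilde A_\phi(x)$ and $\beta\in\tilde A_\phi(y_i)$, the path $P_\phi(y_i,\alpha,\beta)$ ends at $x$. (d) For all $i,j\in[p]$ with $y_i\neq y_j$, $\tilde A_\phi(y_i)\cap\tilde A_\phi(y_j)=\emptyset$. (e) If the multi-fan $F$ is maximal (cannot be extended to a longer multi-fan at $x$ with respect to $e$ and $\phi$), then $|\{y_1,\dots,y_p\}|\ge2$ and $$\sum_{z\in V(F)}\Big(\pi_F(x,z)-\min\{k,\,d(z)+\pi(z)\}+d_\phi(z)\Big)\ge1,$$ where $V(F)=\{y_1,\dots,y_p\}$, $\pi_F(x,z)=|\{i\in[p]: y_i=z\}|$ is the multiplicity of $xz$ among $e_1,\dots,e_p$, and $d_\phi(z)$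 is the number of coloured edges at $z$.
   Context: A multi-graph $G=(V,E,\iota)$ has a map $\iota:E\to\binom V2$ giving each edge its two distinct end-points; $e=xy$ means $\iota(e)=\{x,y\}$, and $x\in e$ means $x\in\iota(e)$. $\pi(x,y)$ is the number of edges with end-points $x,y$; $d(x)=\sum_{y\ne x}\pi(x,y)$; $\pi(x)=\max_{y\neq x}\pi(x,y)$; $[n]=\{1,\dots,n\}$, $[a,b]=\{a,\dots,b\}$. A partial colouring is a function $\phi$ from $\mathrm{dom}(\phi)\subseteq E$ to $[k]$; it is proper if no two distinct coloured edges sharing a vertex get the same colour, and local if every coloured edge $e$ has an end-point $x$ with $\phi(e)\le d(x)+\pi(x)$. $A_\phi(x)=[k]\setminus\{\phi(f): f\ni x, f\in\mathrm{dom}(\phi)\}$, $\tilde A_\phi(x)=A_\phi(x)\cap[d(x)+\pi(x)]$, and the potential is $\Phi(\phi)=\sum_{x\in V}|\tilde A_\phi(x)|$. A $\phi$-chain is a sequence of distinct edges $C=(e_1,\dots,e_p)$ such that $e_1$ is the only uncoloured edge among them and consecutive edges $e_i,e_{i+1}$ share exactly one vertex. The $C$-shift of $\phi$ is the partial colouring $\phi'$ with domain $(\mathrm{dom}(\phi)\setminus\{e_p\})\cup\{e_1\}$ agreeing with $\phi$ except $\phi'(e_i)=\phi(e_{i+1})$ for $i\in[p-1]$ ($e_p$ becomes uncoloured). A chain $(e,e')$ with $e=xy$, $e'=xz$ is $\phi$-safe if $\phi(e')\le d(y)+\pi(y)$ and no edge at $y$ has colour $\phi(e')$. A chain $(e_1,\dots,e_m)$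 with $m\ge3$ is $\phi$-safe if for every $i\in[m-1]$ the chain $(e_i,e_{i+1})$ is $\phi_i$-safe, where $\phi_i$ is the $(e_1,\dots,e_i)$-shift of $\phi$ (with the one-edge chain $(e_1)$ regarded as safe and its shift equal to $\phi$). A chain $C=(e_1,\dots,e_p)$ is improving if it is $\phi$-safe and either the $C$-shift $\phi'$ satisfies $\Phi(\phi')<\Phi(\phi)$, or $\phi'$ can be extended by colouring $e_p$ so that it remains proper and local. A chain is Vizing if it starts with edges $f_1,\dots,f_q$ ($q\ge1$) all containing a common vertex $z$, and then continues with a (possibly empty) initial segment of a bichromatic path starting at $y$, where $y\ne z$ is the other end-point of $f_q$. For a vertex $v$ and distinct colours $\alpha,\beta$ with $\beta$ missing at $v$, $P_\phi(v,\alpha,\beta)$ denotes the sequence of edges of the maximal path starting at $v$ whose edges are coloured alternately $\alpha,\beta,\alpha,\dots$ (starting with $\alpha$); it is empty if $\alpha$ is missing at $v$. A multi-fan at $x$ with respect to an uncoloured edge $e\ni x$ and $\phi$ is a sequence $F=(e_1,y_1,\dots,e_p,y_p)$, $p\ge1$, where $e_1,\dots,e_p$ are distinct edges, $e_1=e$, $e_i=xy_i$ for all $i\in[p]$, and for every $i\in[2,p]$ there is $j\in[i-1]$ with $\phi(e_i)\in\tilde A_\phi(y_j)$ (in particular $e_i$ is coloured). -}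

module Defs where

open import Data.Nat using (ℕ; zero; suc; _+_; _≤_; _<_; _⊔_; _≡ᵇ_; _≤ᵇ_)
open import Data.Integer as ℤ using (ℤ; +_)
open import Data.Fin as Fin using (Fin; toℕ)
open import Data.Bool using (Bool; true; false; _∧_; _∨_; not; T)
open import Data.Maybe using (Maybe; just; nothing)
open import Data.List using (List; []; _∷_; _++_; _∷ʳ_; map; length; filterᵇ; allFin; upTo; foldr; foldl)
open import Data.Bool.ListAction using (any)
open import Data.List.Membership.Propositional using (_∈_)
open import Data.List.Relation.Unary.All using (All)
open import Data.List.Relation.Unary.Unique.Propositional using (Unique)
open import Data.List.Relation.Unary.Linked using (Linked)
open import Data.Product using (Σ; ∃; ∃-syntax; _×_; _,_; proj₁; proj₂)
open import Data.Sum using (_⊎_)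
open import Data.Unit using (⊤)
open import Data.Empty using (⊥)
open import Relation.Nullary using (¬_; does)
open import Relation.Binary.PropositionalEquality using (_≡_; _≢_)

-- Finite multi-graphs: vertices Fin n, edges Fin m, each edge has two
-- distinct end-points (stored as an ordered pair; only the unordered
-- pair {proj₁, proj₂} matters below).

record MultiGraph : Set where
  field
    n    : ℕ
    m    : ℕ
    ends : Fin m → Fin n × Fin n
    ends-distinct : ∀ e → proj₁ (ends e) ≢ proj₂ (ends e)

module _ (G : MultiGraph) where
  open MultiGraph G

  V : Set
  V = Fin n

  E : Set
  E = Fin m

  _=ᵛ_ : V → V → Bool
  a =ᵛ b = does (a Fin.≟ b)

  _=ᵉ_ : E → E → Bool
  a =ᵉ b = does (a Fin.≟ b)

  _∈ₑ_ : V → E → Set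
  x ∈ₑ e = x ≡ proj₁ (ends e) ⊎ x ≡ proj₂ (ends e)

  incᵇ : V → E → Bool
  incᵇ x e = (x =ᵛ proj₁ (ends e)) ∨ (x =ᵛ proj₂ (ends e))

  Joins : E → V → V → Set
  Joins e x y = (x ≡ proj₁ (ends e) × y ≡ proj₂ (ends e))
              ⊎ (y ≡ proj₁ (ends e) × x ≡ proj₂ (ends e))

  joinsᵇ : E → V → V → Bool
  joinsᵇ e x y = ((x =ᵛ proj₁ (ends e)) ∧ (y =ᵛ proj₂ (ends e)))
               ∨ ((y =ᵛ proj₁ (ends e)) ∧ (x =ᵛ proj₂ (ends e)))

  countᵇ : {A : Set} → (A → Bool) → List A → ℕ
  countᵇ p xs = length (filterᵇ p xs)

  sumℕ : List ℕ → ℕ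
  sumℕ = foldr _+_ 0

  maxℕ : List ℕ → ℕ
  maxℕ = foldr _⊔_ 0

  mult : V → V → ℕ
  mult x y = countᵇ (λ e → joinsᵇ e x y) (allFin m)

  deg : V → ℕ
  deg x = sumℕ (map (mult x) (filterᵇ (λ y → not (y =ᵛ x)) (allFin n)))

  multv : V → ℕ
  multv x = maxℕ (map (mult x) (filterᵇ (λ y → not (y =ᵛ x)) (allFin n)))

  bound : V → ℕ
  bound x = deg x + multv x

  Colouring : Set
  Colouring = E → Maybe ℕ

  colours : ℕ → List ℕ
  colours k = map suc (upTo k)

  InRange : ℕ → ℕ → Set
  InRange k c = 1 ≤ c × c ≤ k

  ColoursIn : ℕ → Colouring → Set
  ColoursIn k φ = ∀ e c → φ e ≡ just c → InRange k c

  Proper : Colouring → Set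
  Proper φ = ∀ e f x c → e ≢ f → x ∈ₑ e → x ∈ₑ f →
             φ e ≡ just c → φ f ≡ just c → ⊥

  Local : Colouring → Set
  Local φ = ∀ e c → φ e ≡ just c → ∃[ x ] (x ∈ₑ e × c ≤ bound x)

  isColour : Maybe ℕ → ℕ → Bool
  isColour nothing  c = false
  isColour (just a) c = a ≡ᵇ c

  isColoured : Maybe ℕ → Bool
  isColoured nothing  = false
  isColoured (just _) = true

  usedAt : Colouring → V → ℕ → Bool
  usedAt φ x c = any (λ f → incᵇ x f ∧ isColour (φ f) c) (allFin m)

  Avail : ℕ → Colouring → V → List ℕ
  Avail k φ x = filterᵇ (λ c → not (usedAt φ x c)) (colours k)

  AvailT : ℕ → Colouring → V → List ℕ
  AvailT k φ x = filterᵇ (λ c → c ≤ᵇ bound x) (Avail k φ x)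

  potential : ℕ → Colouring → ℕ
  potential k φ = sumℕ (map (λ x → length (AvailT k φ x)) (allFin n))

  degCol : Colouring → V → ℕ
  degCol φ z = countᵇ (λ f → incᵇ z f ∧ isColoured (φ f)) (allFin m)

  ShareExactlyOne : E → E → Set
  ShareExactlyOne e f = ∃[ v ] (v ∈ₑ e × v ∈ₑ f × (∀ w → w ∈ₑ e → w ∈ₑ f → w ≡ v))

  Coloured : Colouring → E → Set
  Coloured φ f = ∃[ c ] (φ f ≡ just c)

  IsChain : Colouring → List E → Set
  IsChain φ []       = ⊥
  IsChain φ (e ∷ es) = φ e ≡ nothing × All (Coloured φ) es × Unique (e ∷ es)
                       × Linked ShareExactlyOne (e ∷ es)

  shift : Colouring → List E → Colouring
  shift φ []             f = φ f
  shift φ (e ∷ [])       f = if (f =ᵉ e) then nothing else φ f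
    where open import Data.Bool using (if_then_else_)
  shift φ (e ∷ e′ ∷ es)  f = if (f =ᵉ e) then φ e′ else shift φ (e′ ∷ es) f
    where open import Data.Bool using (if_then_else_)

  Safe2 : Colouring → E → E → Set
  Safe2 ψ e e′ = ∃[ x ] ∃[ y ] ∃[ c ]
    (Joins e x y × x ∈ₑ e′ × ψ e′ ≡ just c × c ≤ bound y
     × (∀ f → y ∈ₑ f → ψ f ≢ just c))

  SafeFrom : Colouring → List E → List E → Set
  SafeFrom φ pre []            = ⊤
  SafeFrom φ pre (e ∷ [])      = ⊤
  SafeFrom φ pre (e ∷ e′ ∷ es) = Safe2 (shift φ (pre ∷ʳ e)) e e′
                                 × SafeFrom φ (pre ∷ʳ e) (e′ ∷ es)

  Safe : Colouring → List E → Set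
  Safe φ C = SafeFrom φ [] C

  extend : Colouring → E → ℕ → Colouring
  extend ψ e c f = if (f =ᵉ e) then just c else ψ f
    where open import Data.Bool using (if_then_else_)

  Improving : ℕ → Colouring → List E → Set
  Improving k φ C = Safe φ C ×
    (potential k (shift φ C) < potential k φ
     ⊎ ∃[ C′ ] ∃[ ep ] (C ≡ C′ ∷ʳ ep ×
         ∃[ c ] (InRange k c × Proper (extend (shift φ C) ep c)
                             × Local (extend (shift φ C) ep c))))

  WalkFrom : V → List (E × V) → Set
  WalkFrom v []             = ⊤
  WalkFrom v ((e , w) ∷ s)  = Joins e v w × WalkFrom w s

  IsPath : V → List (E × V) → Set
  IsPath v s = WalkFrom v s × Unique (v ∷ map proj₂ s)

  AltCol : Colouring → ℕ → ℕ → List (E × V) → Set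
  AltCol φ α β []            = ⊤
  AltCol φ α β ((e , _) ∷ s) = φ e ≡ just α × AltCol φ β α s

  endpoint : V → List (E × V) → V
  endpoint v s = foldl (λ _ st → proj₂ st) v s

  AltPath : Colouring → V → ℕ → ℕ → List (E × V) → Set
  AltPath φ v α β s = IsPath v s × AltCol φ α β s

  MaxAltPath : Colouring → V → ℕ → ℕ → List (E × V) → Set
  MaxAltPath φ v α β s = AltPath φ v α β s
                       × (∀ e w → ¬ AltPath φ v α β (s ∷ʳ (e , w)))

  -- Vizing chain: f_1 … f_q all containing z, followed by (an initial
  -- segment of) a bichromatic path starting at y, the other end of f_q.
  Vizing : Colouring → List E → Set
  Vizing φ C = ∃[ fs ] ∃[ fq ] ∃[ z ] ∃[ y ] ∃[ s ] ∃[ α ] ∃[ β ]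
    (C ≡ (fs ∷ʳ fq) ++ map proj₁ s
     × All (z ∈ₑ_) (fs ∷ʳ fq) × Joins fq z y
     × α ≢ β × IsPath y s × AltCol φ α β s)

  -- Multi-fans at x w.r.t. e, of length p, given as e_i = es i, y_i = ys i
  -- (indices 0,…,p-1 stand for 1,…,p).

  IsMultiFan : ℕ → Colouring → E → V → (p : ℕ) → (Fin p → E) → (Fin p → V) → Set
  IsMultiFan k φ e x p es ys =
    (∀ i j → es i ≡ es j → i ≡ j)
    × (∀ i → toℕ i ≡ 0 → es i ≡ e)
    × (∀ i → Joins (es i) x (ys i))
    × (∀ i → 0 < toℕ i →
         ∃[ j ] (toℕ j < toℕ i × ∃[ c ] (φ (es i) ≡ just c × c ∈ AvailT k φ (ys j))))

  MaximalFan : ℕ → Colouring → E → V → (p : ℕ) → (Fin p → E) → (Fin p → V) → Set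
  MaximalFan k φ e x p es ys =
    ∀ p′ (es′ : Fin p′ → E) (ys′ : Fin p′ → V) → p < p′ →
      (∀ (i : Fin p) (i′ : Fin p′) → toℕ i ≡ toℕ i′ → es′ i′ ≡ es i × ys′ i′ ≡ ys i) →
      ¬ IsMultiFan k φ e x p′ es′ ys′

  fanMult : (p : ℕ) → (Fin p → V) → V → ℕ
  fanMult p ys z = countᵇ (λ i → ys i =ᵛ z) (allFin p)

  fanVerts : (p : ℕ) → (Fin p → V) → List V
  fanVerts p ys = filterᵇ (λ z → any (λ i → ys i =ᵛ z) (allFin p)) (allFin n)

  fanSum : ℕ → Colouring → (p : ℕ) → (Fin p → V) → ℤ
  fanSum k φ p ys = foldr ℤ._+_ (+ 0)
    (map (λ z → ((+ fanMult p ys z) ℤ.- (+ (k ⊓ bound z))) ℤ.+ (+ degCol φ z))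
         (fanVerts p ys))
    where open import Data.Nat using (_⊓_)

  lastIndex : {p : ℕ} → Fin p → List (Fin p) → Fin p
  lastIndex i is = foldl (λ _ j → j) i is

module Submission where

-- Moving the colour c of an edge uz to an uncoloured edge uy, where c ≤ bound y is missing at y,
-- keeps a colouring proper and local.  In the potential, y loses c and z gains c, the latter only
-- if c ≤ bound z; so on a safe Vizing chain c > bound z would give an improving chain.
-- Hence, after the shift along a fan chain ending in e_i, a bichromatic α/β-path from y_i can be
-- shifted edge by edge: both colours stay within the bounds of the vertices it reaches.  If the
-- path avoids x, its last edge can finally be coloured, a contradiction; this is (c).  Only a fan
-- edge x y_j recoloured with β could interfere at the end of the path, but then β is available at
-- y_j as well and induction on i, together with uniqueness of alternating walks, excludes it.
-- Tracing the alternating walk back from x gives (d), and (e) counts the colours available at the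
-- fan vertices, which all occur on coloured fan edges.

open import Defs
open import Data.Nat using (ℕ; zero; suc; _+_; _≤?_; _≤_; _<_; _⊔_; _⊓_; z≤n; s≤s; s≤s⁻¹; _≤ᵇ_)
open import Data.Nat.Properties using (n≮n; <-trans; m≤m+n; m<m+n; +-monoˡ-≤; +-cancelˡ-≤; m⊓n≤m;
    m⊓n≤n; ⊔-sel; ⊓-glb; ≤-trans; ≤-reflexive; +-suc; +-mono-≤; +-monoʳ-≤; +-comm; +-identityʳ;
    ≤ᵇ⇒≤; ≤⇒≤ᵇ; ≡ᵇ⇒≡; ≡⇒≡ᵇ; suc-injective; <⇒≱)
open import Data.Fin.Properties using (any?; toℕ-↑ˡ; toℕ-↑ʳ; toℕ-injective; toℕ<n; splitAt-↑ˡ;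
    splitAt-↑ʳ; join-splitAt)
open import Data.Fin.Induction using (<-wellFounded)
open import Induction.WellFounded using (Acc; acc)
open import Data.Integer as ℤ using (+_)
import Data.Integer.Properties as ℤ
import Data.Integer.Tactic.RingSolver as ℤ-Solver
import Data.Nat.Tactic.RingSolver as ℕ-Solver
open import Data.Fin using (toℕ; splitAt; _↑ˡ_; _↑ʳ_; Fin; zero; suc; _≟_) renaming (_<_ to _<ᶠ_)
open import Data.Bool.ListAction using (any)
open import Data.Bool using (Bool; true; false; T; not; _∧_)
open import Data.Bool.Properties using (T?; T-∧; T-not-≡)
open import Data.Maybe using (just; nothing; fromMaybe)
open import Data.Maybe.Properties using (just-injective)
open import Data.List using (List; []; _∷_; _++_; _∷ʳ_; [_]; map; length; concatMap; allFin; upTo;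
    filterᵇ; foldl)
open import Data.List.Properties using (length-tabulate; length-upTo; length-++; length-map;
    ++-assoc; map-++; foldl-∷ʳ; ++-identityʳ; ∷ʳ-++)
open import Data.List.Membership.Propositional using (_∈_; _∉_; lose; find)
open import Data.List.Membership.Propositional.Properties using (∈-∃++; ∈-++⁺ˡ; ∈-++⁺ʳ; ∈-++⁻;
    ∈-concatMap⁺; ∈-concatMap⁻; ∈-filter⁺; ∈-filter⁻; ∈-map⁺; ∈-map⁻; ∈-upTo⁺; ∈-upTo⁻; ∈-allFin)
open import Data.List.Relation.Binary.Subset.Propositional using (_⊆_)
open import Data.List.Relation.Unary.All as All using (All; []; _∷_)
import Data.List.Relation.Unary.All.Properties as All
open import Data.List.Relation.Unary.AllPairs using ([]; _∷_)
open import Data.List.Relation.Unary.Any using (here; there)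
open import Data.List.Relation.Unary.Any.Properties using (any⁺; any⁻)
open import Data.List.Relation.Unary.Linked using (Linked; []; [-]; _∷_)
open import Data.List.Relation.Unary.Unique.Propositional using (Unique)
import Data.List.Relation.Unary.Unique.Propositional.Properties as Unique
open import Data.Product using (∃-syntax; _×_; _,_; proj₁; proj₂)
open import Data.Product.Properties using (,-injectiveʳ; ,-injectiveˡ)
open import Data.Sum using (_⊎_; inj₁; inj₂; [_,_]′)
open import Data.Unit using (tt)
open import Data.Empty using (⊥; ⊥-elim)
open import Function using (_∘_; id)
open import Function.Bundles using (Equivalence)
open import Relation.Nullary using (¬_; yes; no; contradiction)
open import Relation.Binary.PropositionalEquality using (_≡_; _≢_; refl; sym; trans; cong; cong₂;
    subst; subst₂)

-- Lists without repetitions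

module _ {A : Set} where

  -- The pigeonhole principle behind every count below: potentials, degrees, path lengths and the
  -- fan sum are compared through inclusions of duplicate-free lists.
  Unique-⊆⇒length≤ : {xs ys : List A} → Unique xs → xs ⊆ ys → length xs ≤ length ys
  Unique-⊆⇒length≤ {[]} _ _ = z≤n
  Unique-⊆⇒length≤ {x ∷ xs} (x∉xs ∷ uniq) sub with ∈-∃++ (sub (here refl))
  ... | as , bs , refl =
    ≤-trans (s≤s (Unique-⊆⇒length≤ uniq sub′))
            (≤-reflexive (trans (cong suc (length-++ as)) (trans (sym (+-suc (length as) _)) (sym (length-++ as)))))
    where
    sub′ : xs ⊆ as ++ bs
    sub′ {y} y∈xs with ∈-++⁻ as (sub (there y∈xs))
    ... | inj₁ y∈as         = ∈-++⁺ˡ y∈as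
    ... | inj₂ (here refl)  = contradiction refl (All.lookup x∉xs y∈xs)
    ... | inj₂ (there y∈bs) = ∈-++⁺ʳ as y∈bs

  Unique-∷ʳ⁺ : {xs : List A} {x : A} → Unique xs → x ∉ xs → Unique (xs ∷ʳ x)
  Unique-∷ʳ⁺ uniq x∉xs = Unique.++⁺ uniq ([] ∷ []) λ { (x∈ , here refl) → x∉xs x∈ }

  ∉⇒All≢ : {xs : List A} {x : A} → x ∉ xs → All (x ≢_) xs
  ∉⇒All≢ x∉xs = All.tabulate λ { y∈xs refl → x∉xs y∈xs }

  Linked-∷ʳ⁺ : {R : A → A → Set} (xs : List A) {x y : A} →
               Linked R (xs ∷ʳ x) → R x y → Linked R ((xs ∷ʳ x) ∷ʳ y)
  Linked-∷ʳ⁺ []           _        r = r ∷ [-]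
  Linked-∷ʳ⁺ (_ ∷ [])     (r′ ∷ l) r = r′ ∷ Linked-∷ʳ⁺ [] l r
  Linked-∷ʳ⁺ (_ ∷ z ∷ xs) (r′ ∷ l) r = r′ ∷ Linked-∷ʳ⁺ (z ∷ xs) l r

  Linked-lastIndex : {R : A → A → Set} (x : A) (xs : List A) {y : A} →
                     Linked R (x ∷ xs) → R (foldl (λ _ z → z) x xs) y → Linked R (x ∷ (xs ∷ʳ y))
  Linked-lastIndex x []       _       r = r ∷ [-]
  Linked-lastIndex x (z ∷ xs) (r′ ∷ l) r = r′ ∷ Linked-lastIndex z xs l r

module _ {A B : Set} {f : A → List B} where

  concatMap-∈⁺ : ∀ {xs x y} → x ∈ xs → y ∈ f x → y ∈ concatMap f xs
  concatMap-∈⁺ x∈ y∈ = ∈-concatMap⁺ f (lose x∈ y∈)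

  concatMap-∈⁻ : ∀ {y} xs → y ∈ concatMap f xs → ∃[ x ] (x ∈ xs × y ∈ f x)
  concatMap-∈⁻ xs y∈ = find (∈-concatMap⁻ f {xs = xs} y∈)

  Unique-concatMap : ∀ {xs} → Unique xs → (∀ x → Unique (f x)) →
    (∀ {x y z} → x ∈ xs → y ∈ xs → x ≢ y → z ∈ f x → z ∈ f y → ⊥) →
    Unique (concatMap f xs)
  Unique-concatMap {[]} _ _ _ = []
  Unique-concatMap {x ∷ xs} (x∉xs ∷ uniq) uniqf disj =
    Unique.++⁺ (uniqf x)
      (Unique-concatMap uniq uniqf λ x∈ y∈ → disj (there x∈) (there y∈))
      λ (z∈fx , z∈rest) → let y , y∈ , z∈fy = concatMap-∈⁻ xs z∈rest in
        disj (here refl) (there y∈) (All.lookup x∉xs y∈) z∈fx z∈fy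

-- Colour shifts and the potential
module _ (G : MultiGraph) where
  open MultiGraph G

  private
    variable
      k      : ℕ
      φ ψ ψ′ : Colouring G
      e e′ f : E G
      u v w y z : V G
      c d    : ℕ

  length-concatMap : {A B : Set} (f : A → List B) (xs : List A) →
    length (concatMap f xs) ≡ sumℕ G (map (length ∘ f) xs)
  length-concatMap f []       = refl
  length-concatMap f (x ∷ xs) =
    trans (length-++ (f x)) (cong (_+_ (length (f x))) (length-concatMap f xs))

  joins-sym : Joins G e u v → Joins G e v u
  joins-sym (inj₁ p) = inj₂ p
  joins-sym (inj₂ p) = inj₁ p

  joins⇒∈ˡ : Joins G e u v → _∈ₑ_ G u e
  joins⇒∈ˡ (inj₁ (p , _)) = inj₁ p
  joins⇒∈ˡ (inj₂ (_ , p)) = inj₂ p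

  joins⇒∈ʳ : Joins G e u v → _∈ₑ_ G v e
  joins⇒∈ʳ {e} = joins⇒∈ˡ {e} ∘ joins-sym {e}

  joins⇒≢ : Joins G e u v → u ≢ v
  joins⇒≢ {e} (inj₁ (p , q)) u≡v = ends-distinct e (trans (sym p) (trans u≡v q))
  joins⇒≢ {e} (inj₂ (p , q)) u≡v = ends-distinct e (trans (sym p) (trans (sym u≡v) q))

  ∈ₑ⇒joins : _∈ₑ_ G u e → ∃[ v ] Joins G e u v
  ∈ₑ⇒joins (inj₁ p) = _ , inj₁ (p , refl)
  ∈ₑ⇒joins (inj₂ p) = _ , inj₂ (refl , p)

  joins-∈-cases : Joins G e u v → _∈ₑ_ G w e → w ≡ u ⊎ w ≡ v
  joins-∈-cases (inj₁ (p , q)) (inj₁ r) = inj₁ (trans r (sym p))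
  joins-∈-cases (inj₁ (p , q)) (inj₂ r) = inj₂ (trans r (sym q))
  joins-∈-cases (inj₂ (p , q)) (inj₁ r) = inj₂ (trans r (sym p))
  joins-∈-cases (inj₂ (p , q)) (inj₂ r) = inj₁ (trans r (sym q))

  joins-unique : Joins G e u v → Joins G e u w → v ≡ w
  joins-unique {e} j j′ with joins-∈-cases {e} j (joins⇒∈ʳ {e} j′)
  ... | inj₁ w≡u = contradiction (sym w≡u) (joins⇒≢ {e} j′)
  ... | inj₂ w≡v = sym w≡v

  incᵇ⁺ : _∈ₑ_ G v e → T (incᵇ G v e)
  incᵇ⁺ {v} {e} v∈e with v ≟ proj₁ (ends e) | v ≟ proj₂ (ends e) | v∈e
  ... | yes _ | _     | _      = tt
  ... | no _  | yes _ | _      = tt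
  ... | no ¬p | no _  | inj₁ p = ¬p p
  ... | no _  | no ¬q | inj₂ q = ¬q q

  incᵇ⁻ : T (incᵇ G v e) → _∈ₑ_ G v e
  incᵇ⁻ {v} {e} t with v ≟ proj₁ (ends e) | v ≟ proj₂ (ends e)
  ... | yes p | _     = inj₁ p
  ... | no _  | yes q = inj₂ q

  joinsᵇ⁺ : Joins G e u v → T (joinsᵇ G e u v)
  joinsᵇ⁺ {e} {u} {v} j
    with u ≟ proj₁ (ends e) | v ≟ proj₂ (ends e) | v ≟ proj₁ (ends e) | u ≟ proj₂ (ends e) | j
  ... | yes _ | yes _ | _     | _     | _            = tt
  ... | no ¬p | _     | _     | _     | inj₁ (p , _) = contradiction p ¬p
  ... | yes _ | no ¬q | _     | _     | inj₁ (_ , q) = contradiction q ¬q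
  ... | no _  | _     | yes _ | yes _ | _            = tt
  ... | yes _ | no _  | yes _ | yes _ | _            = tt
  ... | no _  | _     | no ¬p | _     | inj₂ (p , _) = contradiction p ¬p
  ... | no _  | _     | yes _ | no ¬q | inj₂ (_ , q) = contradiction q ¬q
  ... | yes _ | no _  | no ¬p | _     | inj₂ (p , _) = contradiction p ¬p
  ... | yes _ | no _  | yes _ | no ¬q | inj₂ (_ , q) = contradiction q ¬q

  Missing : Colouring G → V G → ℕ → Set
  Missing φ v c = ∀ f → _∈ₑ_ G v f → φ f ≢ just c

  isColour⁺ : φ f ≡ just c → T (isColour G (φ f) c)
  isColour⁺ {φ} {f} {c} eq rewrite eq = ≡⇒≡ᵇ c c refl

  isColour⁻ : T (isColour G (φ f) c) → φ f ≡ just c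
  isColour⁻ {φ} {f} {c} t with φ f
  ... | just a = cong just (≡ᵇ⇒≡ a c t)

  usedAt⁺ : _∈ₑ_ G v f → φ f ≡ just c → T (usedAt G φ v c)
  usedAt⁺ {v} {f} {φ} v∈f eq = any⁺ _ (lose (∈-allFin f)
    (Equivalence.from T-∧ (incᵇ⁺ {v} {f} v∈f , isColour⁺ {φ} {f} eq)))

  usedAt⁻ : T (usedAt G φ v c) → ∃[ f ] (_∈ₑ_ G v f × φ f ≡ just c)
  usedAt⁻ {φ} {v} {c} t =
    let f , _ , t′ = find (any⁻ (λ f → incᵇ G v f ∧ isColour G (φ f) c) (allFin m) t)
        t₁ , t₂ = Equivalence.to (T-∧ {incᵇ G v f}) t′
    in f , incᵇ⁻ {v} {f} t₁ , isColour⁻ {φ} {f} t₂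

  missing-or-used : ∀ φ v c → Missing φ v c ⊎ ∃[ f ] (_∈ₑ_ G v f × φ f ≡ just c)
  missing-or-used φ v c with T? (usedAt G φ v c)
  ... | yes t = inj₂ (usedAt⁻ {φ} t)
  ... | no ¬t = inj₁ λ f v∈f eq → ¬t (usedAt⁺ {v} {f} {φ} v∈f eq)

  ∈-colours⁺ : InRange G k c → c ∈ colours G k
  ∈-colours⁺ {c = suc c} (_ , c≤k) = ∈-map⁺ suc (∈-upTo⁺ c≤k)

  ∈-colours⁻ : c ∈ colours G k → InRange G k c
  ∈-colours⁻ c∈ with i , i∈ , refl ← ∈-map⁻ suc c∈ = s≤s z≤n , ∈-upTo⁻ i∈

  Unique-colours : ∀ k → Unique (colours G k)
  Unique-colours k = Unique.map⁺ suc-injective (Unique.upTo⁺ k)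

  ∈-Avail⁺ : ∀ k φ v → InRange G k c → Missing φ v c → c ∈ Avail G k φ v
  ∈-Avail⁺ {c} k φ v r miss = ∈-filter⁺ _ (∈-colours⁺ r) (unused (usedAt G φ v c) λ t →
    let f , v∈f , eq = usedAt⁻ {φ} t in miss f v∈f eq)
    where
    unused : ∀ b → ¬ T b → T (not b)
    unused true  ¬t = ¬t tt
    unused false _  = tt

  ∈-Avail⁻ : ∀ k φ v → c ∈ Avail G k φ v → InRange G k c × Missing φ v c
  ∈-Avail⁻ {c} k φ v c∈ =
    let c∈k , t = ∈-filter⁻ (T? ∘ λ c → not (usedAt G φ v c)) {xs = colours G k} c∈
    in ∈-colours⁻ c∈k , λ f v∈f eq →
      subst T (Equivalence.to T-not-≡ t) (usedAt⁺ {v} {f} {φ} v∈f eq)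

  ∈-AvailT⁺ : ∀ k φ v → InRange G k c → c ≤ bound G v → Missing φ v c → c ∈ AvailT G k φ v
  ∈-AvailT⁺ k φ v r c≤ miss = ∈-filter⁺ _ (∈-Avail⁺ k φ v r miss) (≤⇒≤ᵇ c≤)

  ∈-AvailT⁻ : ∀ k φ v → c ∈ AvailT G k φ v → InRange G k c × c ≤ bound G v × Missing φ v c
  ∈-AvailT⁻ {c} k φ v c∈ =
    let c∈A , t = ∈-filter⁻ (T? ∘ λ c → c ≤ᵇ bound G v) {xs = Avail G k φ v} c∈
        r , miss = ∈-Avail⁻ k φ v c∈A
    in r , ≤ᵇ⇒≤ c _ t , miss

  Unique-AvailT : ∀ k φ v → Unique (AvailT G k φ v)
  Unique-AvailT k φ v = Unique.filter⁺ _ (Unique.filter⁺ _ (Unique-colours k))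

  -- The length of this duplicate-free list is the potential, so potentials can be compared by
  -- inclusion.
  availPairs : ℕ → Colouring G → List (V G × ℕ)
  availPairs k φ = concatMap (λ v → map (v ,_) (AvailT G k φ v)) (allFin n)

  length-availPairs : ∀ k φ → length (availPairs k φ) ≡ potential G k φ
  length-availPairs k φ = go (allFin n)
    where
    go : ∀ vs → length (concatMap (λ v → map (v ,_) (AvailT G k φ v)) vs)
                ≡ sumℕ G (map (λ v → length (AvailT G k φ v)) vs)
    go []       = refl
    go (v ∷ vs) = trans (length-++ (map (v ,_) (AvailT G k φ v)))
      (cong₂ _+_ (length-map (v ,_) (AvailT G k φ v)) (go vs))

  ∈-availPairs⁺ : ∀ k φ v → c ∈ AvailT G k φ v → (v , c) ∈ availPairs k φ
  ∈-availPairs⁺ k φ v c∈ = concatMap-∈⁺ (∈-allFin v) (∈-map⁺ (v ,_) c∈)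

  ∈-availPairs⁻ : ∀ k φ v → (v , c) ∈ availPairs k φ → c ∈ AvailT G k φ v
  ∈-availPairs⁻ k φ v p∈
    with v , _ , p∈′ ← concatMap-∈⁻ (allFin n) p∈
    with c , c∈ , refl ← ∈-map⁻ (v ,_) p∈′ = c∈

  Unique-availPairs : ∀ k φ → Unique (availPairs k φ)
  Unique-availPairs k φ = Unique-concatMap (Unique.allFin⁺ n)
    (λ v → Unique.map⁺ ,-injectiveʳ (Unique-AvailT k φ v))
    λ {x} {y} _ _ x≢y p∈ q∈ → disj x≢y (∈-map⁻ (x ,_) p∈) (∈-map⁻ (y ,_) q∈)
    where
    disj : ∀ {x y p} → x ≢ y → ∃[ c ] (c ∈ AvailT G k φ x × p ≡ (x , c)) →
           ∃[ c ] (c ∈ AvailT G k φ y × p ≡ (y , c)) → ⊥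
    disj x≢y (_ , _ , refl) (_ , _ , eq) = x≢y (,-injectiveˡ eq)

  -- ψ′ arises from ψ by moving the colour c of e′ = uz to the uncoloured edge e = uy.
  record Move (ψ ψ′ : Colouring G) (e e′ : E G) (u y z : V G) (c : ℕ) : Set where
    field
      e-joins   : Joins G e u y
      e′-joins  : Joins G e′ u z
      y≢z       : y ≢ z
      uncol     : ψ e ≡ nothing
      col       : ψ e′ ≡ just c
      c≤bound   : c ≤ bound G y
      missing   : Missing ψ y c
      on-e      : ψ′ e ≡ just c
      on-e′     : ψ′ e′ ≡ nothing
      elsewhere : ∀ f → f ≢ e → f ≢ e′ → ψ′ f ≡ ψ f

    forward : ψ f ≡ just d → (f ≡ e′ × d ≡ c) ⊎ ψ′ f ≡ just d
    forward {f} eq with f ≟ e | f ≟ e′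
    ... | yes refl | _        with () ← trans (sym uncol) eq
    ... | no _     | yes refl = inj₁ (refl , just-injective (trans (sym eq) col))
    ... | no f≢e   | no f≢e′  = inj₂ (trans (elsewhere f f≢e f≢e′) eq)

    backward : ψ′ f ≡ just d → (f ≡ e × d ≡ c) ⊎ (f ≢ e × f ≢ e′ × ψ f ≡ just d)
    backward {f} eq with f ≟ e | f ≟ e′
    ... | yes refl | _        = inj₁ (refl , just-injective (trans (sym eq) on-e))
    ... | no _     | yes refl with () ← trans (sym on-e′) eq
    backward {f} eq | no f≢e | no f≢e′ = inj₂ (f≢e , f≢e′ , trans (sym (elsewhere f f≢e f≢e′)) eq)

    -- At `u` the colour `c` was on `e′` before, so by properness no third edge has it there; at `y`
    -- it was missing.
    move-proper : Proper G ψ → Proper G ψ′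
    move-proper prop e₁ e₂ v d e₁≢e₂ v∈e₁ v∈e₂ eq₁ eq₂ with backward eq₁ | backward eq₂
    ... | inj₁ (refl , _)       | inj₁ (refl , _)       = e₁≢e₂ refl
    ... | inj₁ (refl , refl)    | inj₂ (_ , f≢e′ , eq)  = clash v∈e₁ v∈e₂ f≢e′ eq
      where
      clash : ∀ {v f} → _∈ₑ_ G v e → _∈ₑ_ G v f → f ≢ e′ → ψ f ≡ just c → ⊥
      clash {v} {f} v∈e v∈f f≢e′ eq with joins-∈-cases {e} e-joins v∈e
      ... | inj₁ refl = prop f e′ v c f≢e′ v∈f (joins⇒∈ˡ {e′} e′-joins) eq col
      ... | inj₂ refl = missing f v∈f eq
    ... | inj₂ (_ , f≢e′ , eq)  | inj₁ (refl , refl)    with joins-∈-cases {e} e-joins v∈e₂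
    ...   | inj₁ refl = prop e₁ e′ v c f≢e′ v∈e₁ (joins⇒∈ˡ {e′} e′-joins) eq col
    ...   | inj₂ refl = missing e₁ v∈e₁ eq
    move-proper prop e₁ e₂ v d e₁≢e₂ v∈e₁ v∈e₂ eq₁ eq₂
        | inj₂ (_ , _ , eq₁′)   | inj₂ (_ , _ , eq₂′)   = prop e₁ e₂ v d e₁≢e₂ v∈e₁ v∈e₂ eq₁′ eq₂′

    move-local : Local G ψ → Local G ψ′
    move-local loc f d eq with backward eq
    ... | inj₁ (refl , refl)  = y , joins⇒∈ʳ {e} e-joins , c≤bound
    ... | inj₂ (_ , _ , eq′) = loc f d eq′

    move-colours : ColoursIn G k ψ → ColoursIn G k ψ′
    move-colours col-in f d eq with backward eq
    ... | inj₁ (refl , refl)  = col-in e′ c col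
    ... | inj₂ (_ , _ , eq′) = col-in f d eq′

    -- Of the two ends of `e′`, the vertex `u` sees `c` again on `e`; only `z` can gain it.
    move-AvailT : ∀ k v → d ∈ AvailT G k ψ′ v → ¬ (v ≡ z × d ≡ c) → d ∈ AvailT G k ψ v
    move-AvailT {d} k v d∈ ≢zc with r , d≤ , miss ← ∈-AvailT⁻ k ψ′ v d∈ =
      ∈-AvailT⁺ k ψ v r d≤ λ f v∈f eq → occurs f v∈f (forward eq) miss
      where
      occurs : ∀ f → _∈ₑ_ G v f → (f ≡ e′ × d ≡ c) ⊎ ψ′ f ≡ just d → ¬ Missing ψ′ v d
      occurs f v∈f (inj₂ eq)            miss = miss f v∈f eq
      occurs f v∈f (inj₁ (refl , refl)) miss with joins-∈-cases {e′} e′-joins v∈f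
      ... | inj₁ refl = miss e (joins⇒∈ˡ {e} e-joins) on-e
      ... | inj₂ v≡z  = ≢zc (v≡z , refl)

    private
      Unique-pairs : ∀ k → Unique ((y , c) ∷ availPairs k ψ′)
      Unique-pairs k = ∉⇒All≢ (λ p∈ → let _ , _ , miss = ∈-AvailT⁻ k ψ′ y (∈-availPairs⁻ k ψ′ y p∈) in
        miss e (joins⇒∈ʳ {e} e-joins) on-e) ∷ Unique-availPairs k ψ′

      pair-y : ColoursIn G k ψ → (y , c) ∈ availPairs k ψ
      pair-y {k} col-in = ∈-availPairs⁺ k ψ y (∈-AvailT⁺ k ψ y (col-in e′ c col) c≤bound missing)

    -- The pair `(y , c)` is lost, as `e` now carries `c` at `y`, and it pays for the only possible
    -- new pair, `(z , c)`. Adding the former on the left and the latter on the right gives an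
    -- inclusion.
    move-potential≤ : ColoursIn G k ψ → potential G k ψ′ ≤ potential G k ψ
    move-potential≤ {k} col-in = s≤s⁻¹ (subst₂ _≤_
      (cong suc (length-availPairs k ψ′)) (cong suc (length-availPairs k ψ))
      (Unique-⊆⇒length≤ (Unique-pairs k) sub))
      where
      sub : (y , c) ∷ availPairs k ψ′ ⊆ (z , c) ∷ availPairs k ψ
      sub (here refl) = there (pair-y col-in)
      sub {v , d} (there p∈) with v ≟ z | d Data.Nat.≟ c
      ... | yes refl | yes refl = here refl
      ... | yes _    | no d≢c   = there (∈-availPairs⁺ k ψ v
        (move-AvailT k v (∈-availPairs⁻ k ψ′ v p∈) (d≢c ∘ proj₂)))
      ... | no v≢z   | _        = there (∈-availPairs⁺ k ψ v
        (move-AvailT k v (∈-availPairs⁻ k ψ′ v p∈) (v≢z ∘ proj₁)))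

    -- With `c` above the bound of `z`, the pair `(z , c)` cannot appear either, and `(y , c)` is a
    -- net loss.
    move-potential< : ColoursIn G k ψ → ¬ (c ≤ bound G z) → potential G k ψ′ < potential G k ψ
    move-potential< {k} col-in c≰ = subst₂ _≤_
      (cong suc (length-availPairs k ψ′)) (length-availPairs k ψ)
      (Unique-⊆⇒length≤ (Unique-pairs k) sub)
      where
      sub : (y , c) ∷ availPairs k ψ′ ⊆ availPairs k ψ
      sub (here refl) = pair-y col-in
      sub {v , d} (there p∈) = let d∈ = ∈-availPairs⁻ k ψ′ v p∈ in
        ∈-availPairs⁺ k ψ v (move-AvailT k v d∈ λ { (refl , refl) →
          c≰ (proj₁ (proj₂ (∈-AvailT⁻ k ψ′ v d∈))) })

  -- Shifts and safety of a chain growing at its end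

  shift-skip : ∀ {a f} L → f ≢ a → shift G φ (a ∷ (L ∷ʳ e)) f ≡ shift G φ (L ∷ʳ e) f
  shift-skip {a = a} {f} [] f≢a with f ≟ a
  ... | yes f≡a = contradiction f≡a f≢a
  ... | no _    = refl
  shift-skip {a = a} {f} (_ ∷ _) f≢a with f ≟ a
  ... | yes f≡a = contradiction f≡a f≢a
  ... | no _    = refl

  shift-head : ∀ a b L → shift G φ (a ∷ b ∷ L) a ≡ φ b
  shift-head a b L with a ≟ a
  ... | yes _  = refl
  ... | no a≢a = contradiction refl a≢a

  shift-outside : ∀ L → f ∉ L → shift G φ L f ≡ φ f
  shift-outside [] _ = refl
  shift-outside {f} (a ∷ []) f∉ with f ≟ a
  ... | yes f≡a = contradiction (here f≡a) f∉
  ... | no _    = refl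
  shift-outside {f} (a ∷ b ∷ L) f∉ with f ≟ a | shift-outside (b ∷ L) (f∉ ∘ there)
  ... | yes f≡a | _  = contradiction (here f≡a) f∉
  ... | no _    | eq = eq

  shift-last : ∀ L → e ∉ L → shift G φ (L ∷ʳ e) e ≡ nothing
  shift-last {e} [] _ with e ≟ e
  ... | yes _  = refl
  ... | no e≢e = contradiction refl e≢e
  shift-last {e} {φ} (a ∷ L) e∉ =
    trans (shift-skip {φ} L (e∉ ∘ here)) (shift-last {e} {φ} L (e∉ ∘ there))

  shift-∷ʳ-on : ∀ L → e ∉ L → shift G φ ((L ∷ʳ e) ∷ʳ e′) e ≡ φ e′
  shift-∷ʳ-on {e} {φ} {e′} []      _  = shift-head {φ} e e′ []
  shift-∷ʳ-on {e} {φ}      (a ∷ L) e∉ =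
    trans (shift-skip {φ} (L ∷ʳ e) (e∉ ∘ here)) (shift-∷ʳ-on {e} {φ} L (e∉ ∘ there))

  -- Every edge other than the old and the new last one keeps its successor in the chain, hence its
  -- new colour.
  shift-∷ʳ-elsewhere : ∀ L → f ≢ e → f ≢ e′ →
    shift G φ ((L ∷ʳ e) ∷ʳ e′) f ≡ shift G φ (L ∷ʳ e) f
  shift-∷ʳ-elsewhere {f} {e} {e′} [] f≢e f≢e′ with f ≟ e | f ≟ e′
  ... | yes f≡e | _        = contradiction f≡e f≢e
  ... | no _    | yes f≡e′ = contradiction f≡e′ f≢e′
  ... | no _    | no _     = refl
  shift-∷ʳ-elsewhere {f} {e} {e′} {φ} (a ∷ L) f≢e f≢e′ with f ≟ a
  ... | no f≢a   = trans (shift-skip {φ = φ} (L ∷ʳ e) f≢a)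
    (trans (shift-∷ʳ-elsewhere {φ = φ} L f≢e f≢e′) (sym (shift-skip {φ = φ} L f≢a)))
  ... | yes refl = same-head L
    where
    same-head : ∀ L → shift G φ (a ∷ ((L ∷ʳ e) ∷ʳ e′)) a ≡ shift G φ (a ∷ (L ∷ʳ e)) a
    same-head []      = trans (shift-head {φ} a e (e′ ∷ [])) (sym (shift-head {φ} a e []))
    same-head (b ∷ L) = trans (shift-head {φ} a b ((L ∷ʳ e) ∷ʳ e′)) (sym (shift-head {φ} a b (L ∷ʳ e)))

  IsChain-∷ʳ⁺ : ∀ L → IsChain G φ (L ∷ʳ e) → Coloured G φ e′ → e′ ∉ L ∷ʳ e →
    ShareExactlyOne G e e′ → IsChain G φ ((L ∷ʳ e) ∷ʳ e′)
  IsChain-∷ʳ⁺ [] (unc , cols , uniq , linked) col e′∉ share =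
    unc , All.∷ʳ⁺ cols col , Unique-∷ʳ⁺ uniq e′∉ , Linked-∷ʳ⁺ [] linked share
  IsChain-∷ʳ⁺ (a ∷ L) (unc , cols , uniq , linked) col e′∉ share =
    unc , All.∷ʳ⁺ cols col , Unique-∷ʳ⁺ uniq e′∉ , Linked-∷ʳ⁺ (a ∷ L) linked share

  IsChain⇒Unique : ∀ L → IsChain G φ L → Unique L
  IsChain⇒Unique (_ ∷ _) (_ , _ , uniq , _) = uniq

  -- Safety of the new pair refers to the shift along the whole chain before it, so the induction
  -- runs over an arbitrary prefix `pre`; the substitutions only reassociate.
  SafeFrom-∷ʳ⁺ : ∀ pre L → SafeFrom G φ pre (L ∷ʳ e) →
    Safe2 G (shift G φ ((pre ++ L) ∷ʳ e)) e e′ → SafeFrom G φ pre ((L ∷ʳ e) ∷ʳ e′)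
  SafeFrom-∷ʳ⁺ {φ} {e} {e′} pre [] _ safe =
    subst (λ p → Safe2 G (shift G φ (p ∷ʳ e)) e e′) (++-identityʳ pre) safe , tt
  SafeFrom-∷ʳ⁺ {φ} {e} {e′} pre (a ∷ []) (safe₀ , safes) safe = safe₀ , SafeFrom-∷ʳ⁺ (pre ∷ʳ a) [] safes
    (subst (λ p → Safe2 G (shift G φ (p ∷ʳ e)) e e′) (sym (∷ʳ-++ pre a [])) safe)
  SafeFrom-∷ʳ⁺ {φ} {e} {e′} pre (a ∷ b ∷ L) (safe₀ , safes) safe = safe₀ , SafeFrom-∷ʳ⁺ (pre ∷ʳ a) (b ∷ L) safes
    (subst (λ p → Safe2 G (shift G φ (p ∷ʳ e)) e e′) (sym (∷ʳ-++ pre a (b ∷ L))) safe)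

  Unique-∷ʳ⁻ : ∀ {A : Set} L {a : A} → Unique (L ∷ʳ a) → a ∉ L
  Unique-∷ʳ⁻ (_ ∷ L) (a∉ ∷ _)    (here refl) = All.lookup a∉ (∈-++⁺ʳ L (here refl)) refl
  Unique-∷ʳ⁻ (_ ∷ L) (_ ∷ uniq) (there a∈)  = Unique-∷ʳ⁻ L uniq a∈

  -- Invariant of a growing chain whose last edge `e` is the one left uncoloured by the shift. With
  -- the potential not raised so far, a strict drop at the next move makes the longer chain
  -- improving.
  record SafeChain (k : ℕ) (φ : Colouring G) (L : List (E G)) (e : E G) : Set where
    field
      chain      : IsChain G φ (L ∷ʳ e)
      safe       : Safe G φ (L ∷ʳ e)
      proper     : Proper G (shift G φ (L ∷ʳ e))
      local      : Local G (shift G φ (L ∷ʳ e))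
      colours-in : ColoursIn G k (shift G φ (L ∷ʳ e))
      potential≤ : potential G k (shift G φ (L ∷ʳ e)) ≤ potential G k φ

    e∉L : e ∉ L
    e∉L = Unique-∷ʳ⁻ L (IsChain⇒Unique (L ∷ʳ e) chain)

    uncoloured : shift G φ (L ∷ʳ e) e ≡ nothing
    uncoloured = shift-last {e} {φ} L e∉L

  module _ {L} (s : SafeChain k φ L e)
           (e-joins : Joins G e u y) (e′-joins : Joins G e′ u z) (y≢z : y ≢ z)
           (e′∉ : e′ ∉ L ∷ʳ e) (col : φ e′ ≡ just c) (c≤ : c ≤ bound G y)
           (miss : Missing (shift G φ (L ∷ʳ e)) y c) where
    open SafeChain s

    -- The shift along the longer chain is one `Move` applied to the shift before it, in which `e′`
    -- still has its original colour.
    snoc-move : Move (shift G φ (L ∷ʳ e)) (shift G φ ((L ∷ʳ e) ∷ʳ e′)) e e′ u y z c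
    snoc-move = record
      { e-joins   = e-joins
      ; e′-joins  = e′-joins
      ; y≢z       = y≢z
      ; uncol     = uncoloured
      ; col       = trans (shift-outside {e′} {φ} (L ∷ʳ e) e′∉) col
      ; c≤bound   = c≤
      ; missing   = miss
      ; on-e      = trans (shift-∷ʳ-on {e} {φ} L e∉L) col
      ; on-e′     = shift-last {e′} {φ} (L ∷ʳ e) e′∉
      ; elsewhere = λ f → shift-∷ʳ-elsewhere {f} {e} {e′} {φ} L
      }

    open Move snoc-move using (move-proper; move-local; move-colours; move-potential≤; move-potential<)

    snoc-SafeChain : SafeChain k φ (L ∷ʳ e) e′
    snoc-SafeChain = record
      { chain      = IsChain-∷ʳ⁺ {φ} {e} {e′} L chain (_ , col) e′∉
                       (u , joins⇒∈ˡ {e} e-joins , joins⇒∈ˡ {e′} e′-joins , shared)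
      ; safe       = SafeFrom-∷ʳ⁺ {φ} {e} {e′} [] L safe
                       (u , y , _ , e-joins , joins⇒∈ˡ {e′} e′-joins , Move.col snoc-move , c≤ , miss)
      ; proper     = move-proper proper
      ; local      = move-local local
      ; colours-in = move-colours colours-in
      ; potential≤ = ≤-trans (move-potential≤ colours-in) potential≤
      }
      where
      shared : ∀ w → _∈ₑ_ G w e → _∈ₑ_ G w e′ → w ≡ u
      shared w w∈e w∈e′ with joins-∈-cases {e} e-joins w∈e | joins-∈-cases {e′} e′-joins w∈e′
      ... | inj₁ w≡u | _        = w≡u
      ... | inj₂ _   | inj₁ w≡u = w≡u
      -- This excludes parallel edges, which would share both end-points.
      ... | inj₂ w≡y | inj₂ w≡z = contradiction (trans (sym w≡y) w≡z) y≢z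

    snoc-improving : ¬ (c ≤ bound G z) → Improving G k φ ((L ∷ʳ e) ∷ʳ e′)
    snoc-improving c≰ = SafeChain.safe snoc-SafeChain ,
      inj₁ (≤-trans (move-potential< colours-in c≰) potential≤)

  -- That `c` is missing at both ends keeps the extension proper; the bound at one end keeps it
  -- local.
  extend-improving : ∀ {L} → SafeChain k φ L e → Joins G e u v → InRange G k c →
    Missing (shift G φ (L ∷ʳ e)) u c → Missing (shift G φ (L ∷ʳ e)) v c →
    c ≤ bound G u ⊎ c ≤ bound G v → Improving G k φ (L ∷ʳ e)
  extend-improving {k} {φ} {e} {u} {v} {c} {L} s j r miss-u miss-v c≤ =
    safe , inj₂ (L , e , refl , c , r , ext-proper , ext-local)
    where
    open SafeChain s
    shifted = shift G φ (L ∷ʳ e)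

    missing : ∀ {w} → _∈ₑ_ G w e → Missing shifted w c
    missing w∈e with joins-∈-cases {e} j w∈e
    ... | inj₁ refl = miss-u
    ... | inj₂ refl = miss-v

    ext-proper : Proper G (extend G shifted e c)
    ext-proper e₁ e₂ w d e₁≢e₂ w∈e₁ w∈e₂ eq₁ eq₂ with e₁ ≟ e | e₂ ≟ e
    ... | yes refl | yes refl = e₁≢e₂ refl
    ... | yes refl | no _     = missing w∈e₁ e₂ w∈e₂ (trans eq₂ (sym eq₁))
    ... | no _     | yes refl = missing w∈e₂ e₁ w∈e₁ (trans eq₁ (sym eq₂))
    ... | no _     | no _     = proper e₁ e₂ w d e₁≢e₂ w∈e₁ w∈e₂ eq₁ eq₂

    ext-local : Local G (extend G shifted e c)
    ext-local f d eq with f ≟ e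
    ... | no _     = local f d eq
    ... | yes refl with refl ← eq =
      [ (λ c≤u → u , joins⇒∈ˡ {e} j , c≤u) , (λ c≤v → v , joins⇒∈ʳ {e} j , c≤v) ]′ c≤

-- Alternating paths
module _ (G : MultiGraph) where
  open MultiGraph G

  private
    variable
      k      : ℕ
      φ      : Colouring G
      e f    : E G
      u v w z : V G
      c      : ℕ

  same-edge : Proper G φ → _∈ₑ_ G v e → _∈ₑ_ G v f → φ e ≡ just c → φ f ≡ just c → e ≡ f
  same-edge {e = e} {f} prop v∈e v∈f eq eq′ with e ≟ f
  ... | yes e≡f = e≡f
  ... | no e≢f  = ⊥-elim (prop e f _ _ e≢f v∈e v∈f eq eq′)

  Steps : Set
  Steps = List (E G × V G)

  -- The colour of an edge that would continue the α/β-alternating walk s.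
  nextColour : ℕ → ℕ → Steps → ℕ
  nextColour α β []      = α
  nextColour α β (_ ∷ s) = nextColour β α s

  nextColour-cases : ∀ α β s →
    (nextColour α β s ≡ α × nextColour β α s ≡ β) ⊎ (nextColour α β s ≡ β × nextColour β α s ≡ α)
  nextColour-cases α β []      = inj₁ (refl , refl)
  nextColour-cases α β (_ ∷ s) = [ inj₂ , inj₁ ]′ (nextColour-cases β α s)

  endpoint-∈ : ∀ v s → endpoint G v s ∈ v ∷ map proj₂ s
  endpoint-∈ v []            = here refl
  endpoint-∈ v ((_ , w) ∷ s) = there (endpoint-∈ w s)

  IsPath⇒start∉ : ∀ {p s} → IsPath G v (p ∷ s) → v ∉ map proj₂ (p ∷ s)
  IsPath⇒start∉ (_ , v∉ ∷ _) v∈ = All.lookup v∉ v∈ refl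

  IsPath-tail : ∀ {s} → IsPath G v ((e , w) ∷ s) → IsPath G w s
  IsPath-tail ((_ , walk) , _ ∷ uniq) = walk , uniq

  endpoint≢start : ∀ {s} → IsPath G v ((e , w) ∷ s) → v ≢ endpoint G w s
  endpoint≢start {v} {w = w} {s} path v≡t =
    IsPath⇒start∉ path (subst (_∈ w ∷ map proj₂ s) (sym v≡t) (endpoint-∈ w s))

  walk-avoids : ∀ {s} → WalkFrom G w s → v ∉ w ∷ map proj₂ s → (f , z) ∈ s → ¬ _∈ₑ_ G v f
  walk-avoids {f = f} (j , _)    v∉ (here refl) v∈f with joins-∈-cases G {f} j v∈f
  ... | inj₁ v≡w = v∉ (here v≡w)
  ... | inj₂ v≡z = v∉ (there (here v≡z))
  walk-avoids         (_ , walk) v∉ (there f∈)  v∈f = walk-avoids walk (v∉ ∘ there) f∈ v∈f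

  WalkFrom-∷ʳ⁺ : ∀ v s → WalkFrom G v s → Joins G f (endpoint G v s) w → WalkFrom G v (s ∷ʳ (f , w))
  WalkFrom-∷ʳ⁺ v []            _          j = j , tt
  WalkFrom-∷ʳ⁺ v ((_ , u) ∷ s) (j₀ , walk) j = j₀ , WalkFrom-∷ʳ⁺ u s walk j

  AltCol-∷ʳ⁺ : ∀ {α β} s → AltCol G φ α β s → φ f ≡ just (nextColour α β s) → AltCol G φ α β (s ∷ʳ (f , w))
  AltCol-∷ʳ⁺ []      _           eq = eq , tt
  AltCol-∷ʳ⁺ (_ ∷ s) (eq₀ , alt) eq = eq₀ , AltCol-∷ʳ⁺ s alt eq

  AltPath-∷ʳ⁺ : ∀ {α β} s → AltPath G φ v α β s → Joins G f (endpoint G v s) w →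
    φ f ≡ just (nextColour α β s) → w ∉ v ∷ map proj₂ s → AltPath G φ v α β (s ∷ʳ (f , w))
  AltPath-∷ʳ⁺ {v = v} {f} {w} s ((walk , uniq) , alt) j eq w∉ =
    (WalkFrom-∷ʳ⁺ v s walk j , subst (λ vs → Unique (v ∷ vs)) (sym (map-++ proj₂ s [ f , w ])) (Unique-∷ʳ⁺ uniq w∉)) ,
    AltCol-∷ʳ⁺ s alt eq

  IsPath-++⁻ˡ : ∀ s₁ {s₂} → IsPath G v (s₁ ++ s₂) → IsPath G v s₁
  IsPath-++⁻ˡ []              _                        = tt , [] ∷ []
  IsPath-++⁻ˡ (x ∷ s₁) {s₂} ((j , walk) , v∉ ∷ uniq) =
    let walk₁ , uniq₁ = IsPath-++⁻ˡ s₁ (walk , uniq) in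
    (j , walk₁) , All.++⁻ˡ (map proj₂ (x ∷ s₁)) (subst (All _) (map-++ proj₂ (x ∷ s₁) s₂) v∉) ∷ uniq₁

  AltCol-++⁻ˡ : ∀ {α β} s₁ {s₂} → AltCol G φ α β (s₁ ++ s₂) → AltCol G φ α β s₁
  AltCol-++⁻ˡ []       _          = tt
  AltCol-++⁻ˡ (_ ∷ s₁) (eq , alt) = eq , AltCol-++⁻ˡ s₁ alt

  -- The hypothesis on β-edges at v says that no such edge leads to the end of the path;
  -- for the first vertex of the path it holds because β is missing there.
  end-fresh : Proper G φ → ∀ {α β} → α ≢ β → ∀ v s → AltPath G φ v α β s →
    Joins G f (endpoint G v s) w → φ f ≡ just (nextColour α β s) →
    (v ≢ endpoint G v s → ∀ g → _∈ₑ_ G v g → φ g ≡ just β → ¬ _∈ₑ_ G (endpoint G v s) g) →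
    w ∉ v ∷ map proj₂ s
  end-fresh {f = f} prop α≢β v [] alt j eq no-β (here refl) = joins⇒≢ G {f} j refl
  end-fresh {φ} {f} {w} prop {α} {β} α≢β v ((p , u) ∷ s) (path@((j₀ , walk) , _ ∷ uniq) , col , alt) j eq no-β =
    λ where
      (here w≡v) → no-return w≡v (nextColour-cases β α s)
      (there w∈) → end-fresh {φ} {f} prop (α≢β ∘ sym) u s ((walk , uniq) , alt) j eq no-α w∈
    where
    t≢v : v ≢ endpoint G u s
    t≢v = endpoint≢start path

    t∈p : _∈ₑ_ G (endpoint G u s) p → endpoint G u s ≡ u
    t∈p t∈ with joins-∈-cases G {p} j₀ t∈
    ... | inj₁ t≡v = contradiction (sym t≡v) t≢v
    ... | inj₂ t≡u = t≡u

    -- The recursion at `u` swaps the colours: the only `α`-edge at `u` is `p`, which reaches the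
    -- end of the path only if that end is `u`.
    no-α : u ≢ endpoint G u s → ∀ g → _∈ₑ_ G u g → φ g ≡ just α → ¬ _∈ₑ_ G (endpoint G u s) g
    no-α u≢t g u∈g eq′ t∈g with refl ← same-edge {φ} prop u∈g (joins⇒∈ʳ G {p} j₀) eq′ col =
      u≢t (sym (t∈p t∈g))

    single : ∀ s → IsPath G u s → endpoint G u s ≡ u → nextColour β α s ≡ β
    single []      _     _   = refl
    single (_ ∷ _) path′ t≡u = contradiction (sym t≡u) (endpoint≢start path′)

    -- Back at `v`, the edge `f` is either a `β`-edge, which the hypothesis excludes, or has colour
    -- `α` and equals `p`; then `s` is empty and `f` would have colour `β`.
    no-return : w ≡ v →
      (nextColour β α s ≡ β × nextColour α β s ≡ α) ⊎
      (nextColour β α s ≡ α × nextColour α β s ≡ β) → ⊥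
    no-return refl (inj₁ (next≡β , _)) =
      no-β t≢v f (joins⇒∈ʳ G {f} j) (trans eq (cong just next≡β)) (joins⇒∈ˡ G {f} j)
    no-return refl (inj₂ (next≡α , _))
      with refl ← same-edge {φ} prop (joins⇒∈ʳ G {f} j) (joins⇒∈ˡ G {p} j₀) (trans eq (cong just next≡α)) col =
      α≢β (trans (sym next≡α) (single s (walk , uniq) (t∈p (joins⇒∈ˡ G {f} j))))

  module _ (prop : Proper G φ) {α β} (α≢β : α ≢ β) (β-missing : Missing G φ v β) where

    private
      extendable : ∀ s → AltPath G φ v α β s → _∈ₑ_ G (endpoint G v s) f →
        φ f ≡ just (nextColour α β s) → ∃[ w ] AltPath G φ v α β (s ∷ʳ (f , w))
      extendable {f} s alt t∈f eq = let w , j = ∈ₑ⇒joins G {e = f} t∈f in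
        w , AltPath-∷ʳ⁺ {φ} {f = f} s alt j eq (end-fresh {φ} {f} prop α≢β v s alt j eq
          λ _ g v∈g eq′ _ → β-missing g v∈g eq′)

    -- Maximality alone would allow a next edge that returns to the path; `end-fresh` rules this
    -- out, as `β` is missing at `v`.
    MaxAltPath⇒missing : ∀ {s} → MaxAltPath G φ v α β s → Missing G φ (endpoint G v s) (nextColour α β s)
    MaxAltPath⇒missing {s} (alt , maximal) f t∈f eq =
      let w , alt′ = extendable s alt t∈f eq in maximal f w alt′

    ∃-maximal : ∃[ s ] (AltPath G φ v α β s × Missing G φ (endpoint G v s) (nextColour α β s))
    -- Fuel `n` suffices: a path with `n` steps would have `n + 1` distinct vertices.
    ∃-maximal = grow n [] ((tt , [] ∷ []) , tt) (≤-reflexive (sym (+-identityʳ n)))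
      where
      grow : ∀ fuel s → AltPath G φ v α β s → n ≤ fuel + length s →
        ∃[ s ] (AltPath G φ v α β s × Missing G φ (endpoint G v s) (nextColour α β s))
      grow fuel s alt n≤ with missing-or-used G φ (endpoint G v s) (nextColour α β s)
      ... | inj₁ miss = s , alt , miss
      grow zero s ((_ , uniq) , _) n≤ | inj₂ _ = contradiction
        (subst₂ _≤_ (cong suc (length-map proj₂ s)) (length-tabulate id)
          (Unique-⊆⇒length≤ uniq λ {y} _ → ∈-allFin y))
        (<⇒≱ (s≤s n≤))
      grow (suc fuel) s alt n≤ | inj₂ (f , t∈f , eq) =
        let w , alt′ = extendable s alt t∈f eq in
        grow fuel (s ∷ʳ (f , w)) alt′
          (subst (n ≤_) (trans (sym (+-suc fuel (length s)))
            (cong (_+_ fuel) (trans (+-comm 1 _) (sym (length-++ s))))) n≤)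

  -- A vertex that the path enters and leaves sees both colours.
  on-path⇒end : ∀ {α β} s → AltPath G φ v α β s → w ∈ map proj₂ s →
    Missing G φ w α ⊎ Missing G φ w β → w ≡ endpoint G v s
  on-path⇒end ((p , _) ∷ []) _ (here refl) _ = refl
  on-path⇒end ((p , _) ∷ (p′ , _) ∷ s) (((j , j′ , _) , _) , col , col′ , _) (here refl) miss =
    ⊥-elim ([ (λ α-miss → α-miss p (joins⇒∈ʳ G {p} j) col)
            , (λ β-miss → β-miss p′ (joins⇒∈ˡ G {p′} j′) col′) ]′ miss)
  on-path⇒end ((p , u) ∷ s) (path , _ , alt) (there w∈) miss =
    on-path⇒end s (IsPath-tail path , alt) w∈ ([ inj₂ , inj₁ ]′ miss)

  -- Ray φ v α β t: the maximal walk from v whose edges are coloured α, β, α, … ends in t.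
  data Ray (φ : Colouring G) : V G → ℕ → ℕ → V G → Set where
    stop : ∀ {v α β} → Missing G φ v α → Ray φ v α β v
    go   : ∀ {v α β t} f w → Joins G f v w → φ f ≡ just α → Ray φ w β α t → Ray φ v α β t

  -- Properness forces every step, and a missing colour forces the stop.
  Ray-unique : Proper G φ → ∀ {α β t t′} → Ray φ v α β t → Ray φ v α β t′ → t ≡ t′
  Ray-unique prop (stop _)         (stop _)         = refl
  Ray-unique prop (stop miss)      (go f _ j eq _)  = ⊥-elim (miss f (joins⇒∈ˡ G {f} j) eq)
  Ray-unique prop (go f _ j eq _)  (stop miss)      = ⊥-elim (miss f (joins⇒∈ˡ G {f} j) eq)
  Ray-unique {φ} prop (go f w j eq r) (go f′ w′ j′ eq′ r′)
    with refl ← same-edge {φ} prop (joins⇒∈ˡ G {f} j) (joins⇒∈ˡ G {f′} j′) eq eq′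
    with refl ← joins-unique G {f} j j′ = Ray-unique prop r r′

  AltPath⇒Ray : ∀ {α β} s → WalkFrom G v s → AltCol G φ α β s →
    Missing G φ (endpoint G v s) (nextColour α β s) → Ray φ v α β (endpoint G v s)
  AltPath⇒Ray []            _          _           miss = stop miss
  AltPath⇒Ray ((f , w) ∷ s) (j , walk) (eq , alt) miss = go f w j eq (AltPath⇒Ray s walk alt miss)

  -- Walks `s` backwards and continues with the ray from its start. For nonempty `s` the first
  -- colour is that of its last edge, `nextColour β α s`.
  Ray-reverse : ∀ {α β t} s → WalkFrom G v s → AltCol G φ α β s → Ray φ v β α t →
    Ray φ (endpoint G v s) (nextColour β α s) (nextColour α β s) t
  Ray-reverse []            _          _          r = r
  Ray-reverse {v} ((f , w) ∷ s) (j , walk) (eq , alt) r =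
    Ray-reverse s walk alt (go f v (joins-sym G {f} j) eq r)

  -- The uncoloured edge `e = uv` is pushed along the path: `p = vw` gives its colour `a` to `e`,
  -- and the same situation recurs at `p` with `a` and `b` interchanged. If the next colour were
  -- missing at the end, the last edge could be coloured with it; the hypothesis on shifted colours
  -- at the end transfers this from `φ` to the shift. Every prefix must be Vizing, since the
  -- potential may drop at any move.
  kempe-chain : (∀ C → IsChain G φ C → Vizing G φ C → ¬ Improving G k φ C) →
    ∀ {a b} L s → SafeChain G k φ L e → Joins G e u v →
    (∀ s₁ s₂ → s ≡ s₁ ++ s₂ → Vizing G φ ((L ∷ʳ e) ++ map proj₁ s₁)) →
    AltPath G φ v a b s → u ∉ v ∷ map proj₂ s → (∀ {f z} → (f , z) ∈ s → f ∉ L ∷ʳ e) →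
    a ≢ b → InRange G k a → InRange G k b →
    Missing G (shift G φ (L ∷ʳ e)) u a → a ≤ bound G u →
    Missing G (shift G φ (L ∷ʳ e)) v b → b ≤ bound G v →
    (∀ f c → _∈ₑ_ G (endpoint G v s) f → shift G φ (L ∷ʳ e) f ≡ just c → c ≡ a ⊎ c ≡ b → φ f ≡ just c) →
    ¬ Missing G φ (endpoint G v s) (nextColour a b s)
  kempe-chain {φ} {k} {e} noImp {a} L [] sc j vizing _ _ _ _ r _ miss-u a≤ _ _ same end-miss =
    noImp (L ∷ʳ e) (SafeChain.chain sc)
      (subst (Vizing G φ) (++-identityʳ (L ∷ʳ e)) (vizing [] [] refl))
      (extend-improving G sc j r miss-u
        (λ f v∈f eq → end-miss f v∈f (same f a v∈f eq (inj₁ refl))) (inj₁ a≤))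
  kempe-chain {φ} {k} {e} {u} {v} noImp {a} {b} L ((p , w) ∷ s) sc j vizing
    (path@((jp , walk) , _) , col , alt) u∉ new a≢b ra rb miss-u a≤ miss-v b≤ same end-miss =
    kempe-chain {φ} {k} {p} {v} {w} noImp (L ∷ʳ e) s sc′ jp
      (λ s₁ s₂ eq → subst (Vizing G φ) (sym (++-assoc (L ∷ʳ e) [ p ] (map proj₁ s₁)))
        (vizing ((p , w) ∷ s₁) s₂ (cong ((p , w) ∷_) eq)))
      (IsPath-tail path , alt) v∉ new′ (a≢b ∘ sym) rb ra
      miss-v′ b≤ miss-w a≤w same′ end-miss
    where
    v∉ : v ∉ w ∷ map proj₂ s
    v∉ = IsPath⇒start∉ path

    u≢w : u ≢ w
    u≢w u≡w = u∉ (there (here u≡w))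

    p∉ : p ∉ L ∷ʳ e
    p∉ = new (here refl)

    sc′  = snoc-SafeChain G sc (joins-sym G {e} j) jp u≢w p∉ col a≤ miss-u
    open Move (snoc-move G sc (joins-sym G {e} j) jp u≢w p∉ col a≤ miss-u) using (backward) renaming (col to colₚ)

    -- Otherwise the potential drops at this move and the chain ending in `p` is improving.
    a≤w : a ≤ bound G w
    a≤w with a ≤? bound G w
    ... | yes le = le
    ... | no a≰  = ⊥-elim (noImp _ (SafeChain.chain sc′) (vizing [ p , w ] s refl)
      (snoc-improving G sc (joins-sym G {e} j) jp u≢w p∉ col a≤ miss-u a≰))

    later-∉e : ∀ {t} → t ∈ w ∷ map proj₂ s → ¬ _∈ₑ_ G t e
    later-∉e t∈ t∈e with joins-∈-cases G {e} j t∈e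
    ... | inj₁ refl = u∉ (there t∈)
    ... | inj₂ refl = v∉ t∈

    miss-v′ : Missing G (shift G φ ((L ∷ʳ e) ∷ʳ p)) v b
    miss-v′ f v∈f eq with backward eq
    ... | inj₁ (_ , b≡a)     = a≢b (sym b≡a)
    ... | inj₂ (_ , _ , eq′) = miss-v f v∈f eq′

    -- In the old shift `p` was the only edge at `w` with colour `a`, and it has lost it.
    miss-w : Missing G (shift G φ ((L ∷ʳ e) ∷ʳ p)) w a
    miss-w f w∈f eq with backward eq
    ... | inj₁ (refl , _)      = later-∉e (here refl) w∈f
    ... | inj₂ (_ , f≢p , eq′) = SafeChain.proper sc f p w a f≢p w∈f (joins⇒∈ʳ G {p} jp) eq′ colₚ

    same′ : ∀ f c → _∈ₑ_ G (endpoint G w s) f → shift G φ ((L ∷ʳ e) ∷ʳ p) f ≡ just c →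
            c ≡ b ⊎ c ≡ a → φ f ≡ just c
    same′ f c t∈f eq c≡ with backward eq
    ... | inj₁ (refl , _)    = ⊥-elim (later-∉e (endpoint-∈ w s) t∈f)
    ... | inj₂ (_ , _ , eq′) = same f c t∈f eq′ ([ inj₂ , inj₁ ]′ c≡)

    new′ : ∀ {f z} → (f , z) ∈ s → f ∉ (L ∷ʳ e) ∷ʳ p
    new′ f∈ f∈L with ∈-++⁻ (L ∷ʳ e) f∈L
    ... | inj₁ f∈Le        = new (there f∈) f∈Le
    ... | inj₂ (here refl) = walk-avoids walk v∉ f∈ (joins⇒∈ˡ G {p} jp)

-- Multi-fans
module _ (G : MultiGraph) where
  open MultiGraph G

  private
    variable
      k : ℕ
      φ : Colouring G
      e : E G

  shift-[] : ∀ f {c} → shift G φ [ e ] f ≡ just c → φ f ≡ just c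
  shift-[] {e = e} f eq with f ≟ e
  ... | no _ = eq

  -- The start of every fan chain: as `e` is uncoloured, the shift along `[ e ]` agrees with `φ`
  -- edge by edge.
  uncoloured-SafeChain : Proper G φ → Local G φ → ColoursIn G k φ → φ e ≡ nothing → SafeChain G k φ [] e
  uncoloured-SafeChain {φ} {k} {e} prop loc col-in uncol = record
    { chain      = uncol , [] , [] ∷ [] , [-]
    ; safe       = tt
    ; proper     = λ e₁ e₂ v c e₁≢e₂ v∈e₁ v∈e₂ eq₁ eq₂ →
                     prop e₁ e₂ v c e₁≢e₂ v∈e₁ v∈e₂ (shift-[] {φ} {e} e₁ eq₁) (shift-[] {φ} {e} e₂ eq₂)
    ; local      = λ f c eq → loc f c (shift-[] {φ} {e} f eq)
    ; colours-in = λ f c eq → col-in f c (shift-[] {φ} {e} f eq)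
    ; potential≤ = subst₂ _≤_ (length-availPairs G k shifted₀) (length-availPairs G k φ)
                     (Unique-⊆⇒length≤ (Unique-availPairs G k shifted₀) pairs)
    }
    where
    shifted₀ : Colouring G
    shifted₀ = shift G φ [ e ]

    unshift : ∀ f {c} → φ f ≡ just c → shifted₀ f ≡ just c
    unshift f eq with f ≟ e
    ... | yes refl with () ← trans (sym uncol) eq
    unshift f eq | no _ = eq

    pairs : availPairs G k shifted₀ ⊆ availPairs G k φ
    pairs {v , c} p∈ = let r , c≤ , miss = ∈-AvailT⁻ G k shifted₀ v (∈-availPairs⁻ G k shifted₀ v p∈) in
      ∈-availPairs⁺ G k φ v (∈-AvailT⁺ G k φ v r c≤ λ f v∈f eq → miss f v∈f (unshift f eq))

  -- Counting colours and edges at a vertex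

  colourOf : Colouring G → E G → ℕ
  -- The default `0` is not a colour, as colours start at `1`.
  colourOf φ f = fromMaybe 0 (φ f)

  ∈-mult⁺ : ∀ {v w f} → Joins G f v w → f ∈ filterᵇ (λ f → joinsᵇ G f v w) (allFin m)
  ∈-mult⁺ {v} {w} {f} j = ∈-filter⁺ (T? ∘ λ f → joinsᵇ G f v w) (∈-allFin f) (joinsᵇ⁺ G {f} {v} {w} j)

  -- Each of the first `k ⊓ bound G v` colours is available at `v` or carried by a coloured edge at
  -- `v`.
  bound≤AvailT+degCol : ∀ k φ v → k ⊓ bound G v ≤ length (AvailT G k φ v) + degCol G φ v
  bound≤AvailT+degCol k φ v = subst₂ _≤_
    (trans (length-map suc (upTo b)) (length-upTo b))
    (trans (length-++ (AvailT G k φ v)) (cong (_+_ (length (AvailT G k φ v))) (length-map (colourOf φ) coloured)))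
    (Unique-⊆⇒length≤ (Unique-colours G b) sub)
    where
    b = k ⊓ bound G v
    at-v = λ f → incᵇ G v f ∧ isColoured G (φ f)
    coloured = filterᵇ at-v (allFin m)

    sub : colours G b ⊆ AvailT G k φ v ++ map (colourOf φ) coloured
    sub {c} c∈ with ∈-colours⁻ G c∈ | missing-or-used G φ v c
    ... | 1≤c , c≤b | inj₁ miss = ∈-++⁺ˡ (∈-AvailT⁺ G k φ v
      (1≤c , ≤-trans c≤b (m⊓n≤m k (bound G v))) (≤-trans c≤b (m⊓n≤n k (bound G v))) miss)
    ... | _         | inj₂ (f , v∈f , eq) = ∈-++⁺ʳ (AvailT G k φ v)
      (subst (_∈ map (colourOf φ) coloured) (cong (fromMaybe 0) eq)
        (∈-map⁺ (colourOf φ) (∈-filter⁺ (T? ∘ at-v) (∈-allFin f)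
          (Equivalence.from T-∧ (incᵇ⁺ G {v} {f} v∈f , subst (T ∘ isColoured G) (sym eq) tt)))))

  -- `e` and the coloured edges at `v` are distinct edges at `v`; since `deg` sums over neighbours,
  -- they are regrouped by their other end.
  uncoloured⇒degCol<deg : ∀ φ {v e} → _∈ₑ_ G v e → φ e ≡ nothing → degCol G φ v < deg G v
  uncoloured⇒degCol<deg φ {v} {e} v∈e uncol =
    subst (degCol G φ v <_) (length-concatMap G edgesTo others)
      (Unique-⊆⇒length≤ (∉⇒All≢ e∉ ∷ Unique.filter⁺ (T? ∘ at-v) (Unique.allFin⁺ m)) sub)
    where
    at-v = λ f → incᵇ G v f ∧ isColoured G (φ f)
    coloured = filterᵇ at-v (allFin m)
    edgesTo = λ w → filterᵇ (λ f → joinsᵇ G f v w) (allFin m)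
    others = filterᵇ (λ w → not (_=ᵛ_ G w v)) (allFin n)

    e∉ : e ∉ coloured
    e∉ e∈ with _ , t ← ∈-filter⁻ (T? ∘ at-v) {xs = allFin m} e∈ =
      subst (T ∘ isColoured G) uncol (proj₂ (Equivalence.to (T-∧ {incᵇ G v e}) t))

    ≢⇒T : ∀ w → v ≢ w → T (not (_=ᵛ_ G w v))
    ≢⇒T w v≢w with w ≟ v
    ... | yes w≡v = contradiction (sym w≡v) v≢w
    ... | no _    = tt

    incident : ∀ f → _∈ₑ_ G v f → f ∈ concatMap edgesTo others
    incident f v∈f with w , j ← ∈ₑ⇒joins G {e = f} v∈f =
      concatMap-∈⁺ (∈-filter⁺ (T? ∘ λ w → not (_=ᵛ_ G w v)) (∈-allFin w) (≢⇒T w (joins⇒≢ G {f} j))) (∈-mult⁺ {f = f} j)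

    sub : e ∷ coloured ⊆ concatMap edgesTo others
    sub (here refl) = incident e v∈e
    sub {f} (there f∈) with _ , t ← ∈-filter⁻ (T? ∘ at-v) {xs = allFin m} f∈ =
      incident f (incᵇ⁻ G {v} {f} (proj₁ (Equivalence.to (T-∧ {incᵇ G v f}) t)))

  -- The degree bound enters here: `degCol < deg ≤ k ⊓ bound`, so the coloured edges cannot use up
  -- all colours within the bound.
  ∃-AvailT : ∀ k φ {v e} → deg G v ≤ k → _∈ₑ_ G v e → φ e ≡ nothing → ∃[ c ] (c ∈ AvailT G k φ v)
  ∃-AvailT k φ {v} {e} deg≤k v∈e uncol =
    nonEmpty (AvailT G k φ v) (≤-trans (uncoloured⇒degCol<deg φ {v} {e} v∈e uncol)
      (≤-trans (⊓-glb deg≤k (m≤m+n (deg G v) (multv G v))) (bound≤AvailT+degCol k φ v)))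
    where
    nonEmpty : ∀ cs → degCol G φ v < length cs + degCol G φ v → ∃[ c ] (c ∈ cs)
    nonEmpty []      d<d = contradiction d<d (n≮n _)
    nonEmpty (c ∷ _) _   = c , here refl

  -- Free of truncated subtraction, this bounds the sum of `a - b + d` from below by the sum of
  -- `a - t`.
  sum-exchange : {A : Set} (a b d t : A → ℕ) → (∀ z → b z ≤ t z + d z) → ∀ zs →
    sumℕ G (map b zs) + sumℕ G (map a zs) ≤ sumℕ G (map t zs) + sumℕ G (map (λ z → a z + d z) zs)
  sum-exchange a b d t b≤ []       = z≤n
  sum-exchange a b d t b≤ (z ∷ zs) = subst₂ _≤_ (lhs (b z) (a z) _ _) (rhs (a z) (d z) (t z) _ _)
    (+-mono-≤ (+-monoˡ-≤ (a z) (b≤ z)) (sum-exchange a b d t b≤ zs))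
    where
    lhs : ∀ b a B A → (b + a) + (B + A) ≡ (b + B) + (a + A)
    lhs = ℕ-Solver.solve-∀
    rhs : ∀ a d t T X → ((t + d) + a) + (T + X) ≡ (t + T) + ((a + d) + X)
    rhs = ℕ-Solver.solve-∀

  sum-integer : {A : Set} (a b d : A → ℕ) → ∀ zs →
    Data.List.foldr ℤ._+_ (+ 0) (map (λ z → ((+ a z) ℤ.- (+ b z)) ℤ.+ (+ d z)) zs)
      ≡ + sumℕ G (map (λ z → a z + d z) zs) ℤ.- + sumℕ G (map b zs)
  sum-integer a b d []       = refl
  sum-integer a b d (z ∷ zs) = trans
    (cong (ℤ._+_ (((+ a z) ℤ.- (+ b z)) ℤ.+ (+ d z))) (sum-integer a b d zs))
    (rearrange (+ a z) (+ b z) (+ d z) (+ sumℕ G (map (λ z → a z + d z) zs)) (+ sumℕ G (map b zs)))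
    where
    rearrange : ∀ a b d X Y → ((a ℤ.- b) ℤ.+ d) ℤ.+ (X ℤ.- Y) ≡ ((a ℤ.+ d) ℤ.+ X) ℤ.- (b ℤ.+ Y)
    rearrange = ℤ-Solver.solve-∀

  -- Fan chains and the alternating paths from fan vertices

  module LocalFan (k : ℕ) (φ : Colouring G) (col-in : ColoursIn G k φ) (prop : Proper G φ) (loc : Local G φ)
    (noImp : ∀ C → IsChain G φ C → Vizing G φ C → ¬ Improving G k φ C)
    (e : E G) (uncol : φ e ≡ nothing) (x : V G)
    (q : ℕ) (es : Fin (suc q) → E G) (ys : Fin (suc q) → V G)
    (fan : IsMultiFan G k φ e x (suc q) es ys) where

    es-injective : ∀ i j → es i ≡ es j → i ≡ j
    es-injective = proj₁ fan

    es-joins : ∀ i → Joins G (es i) x (ys i)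
    es-joins = proj₁ (proj₂ (proj₂ fan))

    x∈ : ∀ i → _∈ₑ_ G x (es i)
    x∈ i = joins⇒∈ˡ G {es i} (es-joins i)

    ys∈ : ∀ i → _∈ₑ_ G (ys i) (es i)
    ys∈ i = joins⇒∈ʳ G {es i} (es-joins i)

    es₀-uncoloured : φ (es zero) ≡ nothing
    es₀-uncoloured = trans (cong φ (proj₁ (proj₂ fan) zero refl)) uncol

    -- In the shift along a fan chain, an edge with a new colour is an earlier fan edge es j;
    -- its colour is free at ys j and was that of an edge at x on the chain.
    record FanChain (i : Fin (suc q)) : Set where
      field
        is        : List (Fin (suc q))
        L         : List (E G)
        split     : map es (zero ∷ is) ≡ L ∷ʳ es i
        linked    : Linked _<ᶠ_ (zero ∷ is)
        last      : lastIndex G zero is ≡ i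
        below     : ∀ {f} → f ∈ L → ∃[ j ] (j <ᶠ i × f ≡ es j)
        safeChain : SafeChain G k φ L (es i)

      shifted : Colouring G
      shifted = shift G φ (L ∷ʳ es i)

      field
        origin : ∀ f c → shifted f ≡ just c → φ f ≡ just c ⊎
          ∃[ j ] (j <ᶠ i × f ≡ es j × c ∈ AvailT G k φ (ys j) ×
                  ∃[ g ] (g ∈ L ∷ʳ es i × _∈ₑ_ G x g × φ g ≡ just c))

      -- A colour that is new on some edge comes from an edge at `x`, so a colour missing at `x` is
      -- nowhere new.
      missing-preserved : ∀ {v c} → Missing G φ x c → Missing G φ v c → Missing G shifted v c
      missing-preserved miss-x miss-v f v∈f eq with origin f _ eq
      ... | inj₁ eq′                                    = miss-v f v∈f eq′
      ... | inj₂ (_ , _ , _ , _ , g , _ , x∈g , eq′) = miss-x g x∈g eq′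

      x∈chain : ∀ {f} → f ∈ L ∷ʳ es i → _∈ₑ_ G x f
      x∈chain f∈ with ∈-++⁻ L f∈
      ... | inj₂ (here refl) = x∈ i
      ... | inj₁ f∈L with j , _ , refl ← below f∈L = x∈ j

      vizing : ∀ {α β} s → α ≢ β → AltPath G φ (ys i) α β s → Vizing G φ ((L ∷ʳ es i) ++ map proj₁ s)
      vizing {α} {β} s α≢β (path , alt) = L , es i , x , ys i , s , α , β , refl ,
        All.tabulate x∈chain , es-joins i , α≢β , path , alt

    -- The fan condition names an earlier `j` such that the colour of `es i` is available at `ys j`;
    -- `es i` is appended to the chain for `j`.
    fanChain-acc : ∀ i → Acc _<ᶠ_ i → FanChain i
    fanChain-acc zero _ = record
      { is        = []
      ; L         = []
      ; split     = refl
      ; linked    = [-]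
      ; last      = refl
      ; below     = λ ()
      ; safeChain = uncoloured-SafeChain {φ} {k} {es zero} prop loc col-in es₀-uncoloured
      ; origin    = λ f c eq → inj₁ (shift-[] {φ} {es zero} f eq)
      }
    fanChain-acc i@(suc _) (acc rs) with j , j<i , c , eq , c∈ ← proj₂ (proj₂ (proj₂ fan)) i (s≤s z≤n) = record
      { is        = is ∷ʳ i
      ; L         = L ∷ʳ es j
      ; split     = trans (map-++ es (zero ∷ is) [ i ]) (cong (_∷ʳ es i) split)
      ; linked    = Linked-lastIndex zero is linked (subst (_<ᶠ i) (sym last) j<i)
      ; last      = foldl-∷ʳ (λ _ l → l) zero i is
      ; below     = below′
      ; safeChain = snoc-SafeChain G safeChain (es-joins j) (es-joins i) ys-j≢ys-i es-i∉ eq c≤ miss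
      ; origin    = origin′
      }
      where
      open FanChain (fanChain-acc j (rs j<i))

      c≤ = proj₁ (proj₂ (∈-AvailT⁻ G k φ (ys j) c∈))
      c-missing = proj₂ (proj₂ (∈-AvailT⁻ G k φ (ys j) c∈))

      below′ : ∀ {f} → f ∈ L ∷ʳ es j → ∃[ l ] (l <ᶠ i × f ≡ es l)
      below′ f∈ with ∈-++⁻ L f∈
      ... | inj₂ (here refl) = j , j<i , refl
      ... | inj₁ f∈L         = let l , l<j , f≡ = below f∈L in l , <-trans l<j j<i , f≡

      es-i∉ : es i ∉ L ∷ʳ es j
      es-i∉ es-i∈ with l , l<i , es-i≡ ← below′ es-i∈ with refl ← es-injective i l es-i≡ = n≮n _ l<i

      ys-j≢ys-i : ys j ≢ ys i
      ys-j≢ys-i ys-j≡ = c-missing (es i) (subst (λ v → _∈ₑ_ G v (es i)) (sym ys-j≡) (ys∈ i)) eq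

      -- A recoloured edge with colour `c` would owe it to a chain edge at `x`, which by properness
      -- is `es i`; but `es i` is not yet on the chain.
      miss : Missing G shifted (ys j) c
      miss f v∈f eq′ with origin f c eq′
      ... | inj₁ eq″ = c-missing f v∈f eq″
      ... | inj₂ (_ , _ , _ , _ , g , g∈ , x∈g , eq″)
        with refl ← same-edge G {φ} {e = g} {es i} prop x∈g (x∈ i) eq″ eq = es-i∉ g∈

      open Move (snoc-move G safeChain (es-joins j) (es-joins i) ys-j≢ys-i es-i∉ eq c≤ miss) using (backward)

      origin′ : ∀ f c → shift G φ ((L ∷ʳ es j) ∷ʳ es i) f ≡ just c → φ f ≡ just c ⊎
        ∃[ l ] (l <ᶠ i × f ≡ es l × c ∈ AvailT G k φ (ys l) ×
                ∃[ g ] (g ∈ (L ∷ʳ es j) ∷ʳ es i × _∈ₑ_ G x g × φ g ≡ just c))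
      origin′ f d eq′ with backward eq′
      ... | inj₁ (refl , refl) =
        inj₂ (j , j<i , refl , c∈ , es i , ∈-++⁺ʳ (L ∷ʳ es j) (here refl) , x∈ i , eq)
      ... | inj₂ (_ , _ , eq″) with origin f d eq″
      ...   | inj₁ eq‴ = inj₁ eq‴
      ...   | inj₂ (l , l<j , f≡ , d∈ , g , g∈ , x∈g , eq‴) =
        inj₂ (l , <-trans l<j j<i , f≡ , d∈ , g , ∈-++⁺ˡ g∈ , x∈g , eq‴)

    fanChain : ∀ i → FanChain i
    fanChain i = fanChain-acc i (<-wellFounded i)

    -- This is (b): after the shift along the fan chain, `c` is still missing at both ends of `es i`
    -- and could colour it.
    no-common-missing : ∀ i c → InRange G k c → Missing G φ x c → Missing G φ (ys i) c →
      ¬ (c ≤ bound G x ⊎ c ≤ bound G (ys i))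
    no-common-missing i c r miss-x miss-y c≤ =
      noImp (L ∷ʳ es i) (SafeChain.chain safeChain)
        (subst (Vizing G φ) (++-identityʳ (L ∷ʳ es i))
          -- The path is empty; `0` and `1` merely serve as two distinct colours.
          (vizing {0} {1} [] (λ ()) ((tt , [] ∷ []) , tt)))
        (extend-improving G safeChain (es-joins i) r
          (missing-preserved miss-x miss-x) (missing-preserved miss-x miss-y) c≤)
      where open FanChain (fanChain i)

    module _ {α} (α∈ : α ∈ AvailT G k φ x) where

      private
        α-range = proj₁ (∈-AvailT⁻ G k φ x α∈)
        α≤ = proj₁ (proj₂ (∈-AvailT⁻ G k φ x α∈))
        α-missing = proj₂ (proj₂ (∈-AvailT⁻ G k φ x α∈))

        β-missing : ∀ i {β} → β ∈ AvailT G k φ (ys i) → Missing G φ (ys i) β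
        β-missing i β∈ = proj₂ (proj₂ (∈-AvailT⁻ G k φ (ys i) β∈))

        α≢β : ∀ i {β} → β ∈ AvailT G k φ (ys i) → α ≢ β
        α≢β i β∈ refl = no-common-missing i α α-range α-missing (β-missing i β∈) (inj₁ α≤)

        x≢ys : ∀ i → x ≢ ys i
        x≢ys i = joins⇒≢ G {es i} (es-joins i)

      -- If the path ends elsewhere, `kempe-chain` applies to the fan chain of `i` followed by the
      -- path. The induction hypothesis shows that no recoloured fan edge carries `β` at the start
      -- (`miss-y`) or at the end (`same`) of the path.
      path-ends-at-x : ∀ i → Acc _<ᶠ_ i → ∀ {β} → β ∈ AvailT G k φ (ys i) →
        ∀ s → AltPath G φ (ys i) α β s → Missing G φ (endpoint G (ys i) s) (nextColour G α β s) →
        endpoint G (ys i) s ≡ x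
      path-ends-at-x i (acc rs) {β} β∈ s altPath@(path , alt) end-missing with endpoint G (ys i) s ≟ x
      ... | yes t≡x = t≡x
      ... | no t≢x  = ⊥-elim (kempe-chain G noImp L s safeChain (es-joins i)
          (λ { s₁ s₂ refl → vizing s₁ (α≢β i β∈) (IsPath-++⁻ˡ G s₁ path , AltCol-++⁻ˡ G s₁ alt) })
          altPath x∉ (λ f∈ f∈L → walk-avoids G (proj₁ path) x∉ f∈ (x∈chain f∈L))
          (α≢β i β∈) α-range β-range
          (missing-preserved α-missing α-missing) α≤ miss-y β≤ same end-missing)
        where
        open FanChain (fanChain i)

        t = endpoint G (ys i) s
        β-range = proj₁ (∈-AvailT⁻ G k φ (ys i) β∈)
        β≤ = proj₁ (proj₂ (∈-AvailT⁻ G k φ (ys i) β∈))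

        -- As `x` misses `α`, it can lie on the path only as its end.
        x∉ : x ∉ ys i ∷ map proj₂ s
        x∉ (here x≡) = x≢ys i x≡
        x∉ (there x∈s) = t≢x (sym (on-path⇒end G s altPath x∈s (inj₁ α-missing)))

        -- If `ys i` and `ys j` coincide, the same path starts at `ys j`, and the induction
        -- hypothesis sends it to `x`.
        earlier : ∀ j → j <ᶠ i → β ∈ AvailT G k φ (ys j) → ys i ≢ ys j
        earlier j j<i β∈j ys-i≡ = t≢x (subst (λ v → endpoint G v s ≡ x) (sym ys-i≡)
          (path-ends-at-x j (rs j<i) β∈j s (subst (λ v → AltPath G φ v α β s) ys-i≡ altPath)
            (subst (λ v → Missing G φ (endpoint G v s) (nextColour G α β s)) ys-i≡ end-missing)))

        -- The α/β-path from ys j leads to x, so the one from ys i cannot end at ys j as well.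
        ends-earlier : ∀ j → j <ᶠ i → β ∈ AvailT G k φ (ys j) → t ≢ ys j
        ends-earlier j j<i β∈j t≡ with ∃-maximal G prop (α≢β j β∈j) (β-missing j β∈j)
        ... | s′ , altPath′ , end-missing′ = absurd (nextColour-cases G α β s)
          where
          to-x : Ray G φ t α β x
          to-x = subst₂ (λ v w → Ray G φ v α β w) (sym t≡)
            (path-ends-at-x j (rs j<i) β∈j s′ altPath′ end-missing′)
            (AltPath⇒Ray G s′ (proj₁ (proj₁ altPath′)) (proj₂ altPath′) end-missing′)

          back : Ray G φ t (nextColour G β α s) (nextColour G α β s) (ys i)
          back = Ray-reverse G s (proj₁ path) alt (stop (β-missing i β∈))

          t-misses-β : Missing G φ t β
          t-misses-β = subst (λ v → Missing G φ v β) (sym t≡) (β-missing j β∈j)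

          -- The first colour of the backward ray decides: with `β`, missing at `t`, it stops at
          -- once and `ys i` is `ys j`; with `α`, one and the same ray from `t` ends at both `ys i`
          -- and `x`.
          absurd : (nextColour G α β s ≡ α × nextColour G β α s ≡ β) ⊎
                   (nextColour G α β s ≡ β × nextColour G β α s ≡ α) → ⊥
          absurd (inj₁ (p , q)) = earlier j j<i β∈j (trans
            (Ray-unique G prop (subst₂ (λ a b → Ray G φ t a b (ys i)) q p back) (stop t-misses-β)) t≡)
          absurd (inj₂ (p , q)) = x≢ys i
            (Ray-unique G prop to-x (subst₂ (λ a b → Ray G φ t a b (ys i)) q p back))

        miss-y : Missing G shifted (ys i) β
        miss-y f v∈f eq with origin f β eq
        ... | inj₁ eq′ = β-missing i β∈ f v∈f eq′
        ... | inj₂ (j , j<i , refl , β∈j , _) with joins-∈-cases G {es j} (es-joins j) v∈f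
        ...   | inj₁ ys≡x  = x≢ys i (sym ys≡x)
        ...   | inj₂ ys-i≡ = earlier j j<i β∈j ys-i≡

        -- The colour `α` is never new, being missing at `x`; a new `β` sits on some `es j`, and
        -- then `t` would be `x` or `ys j`.
        same : ∀ f c → _∈ₑ_ G t f → shifted f ≡ just c → c ≡ α ⊎ c ≡ β → φ f ≡ just c
        same f c t∈f eq c≡ with origin f c eq | c≡
        ... | inj₁ eq′ | _ = eq′
        ... | inj₂ (_ , _ , _ , _ , g , _ , x∈g , eq′) | inj₁ refl = ⊥-elim (α-missing g x∈g eq′)
        ... | inj₂ (j , j<i , refl , β∈j , _) | inj₂ refl with joins-∈-cases G {es j} (es-joins j) t∈f
        ...   | inj₁ t≡x = contradiction t≡x t≢x
        ...   | inj₂ t≡  = ⊥-elim (ends-earlier j j<i β∈j t≡)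

      maximal-path-ends-at-x : ∀ i {β} → β ∈ AvailT G k φ (ys i) →
        ∀ s → MaxAltPath G φ (ys i) α β s → endpoint G (ys i) s ≡ x
      maximal-path-ends-at-x i β∈ s maxPath = path-ends-at-x i (<-wellFounded i) β∈ s (proj₁ maxPath)
        (MaxAltPath⇒missing G prop (α≢β i β∈) (β-missing i β∈) maxPath)

      private
        -- The path from `ys i` read backwards from `x`; it starts with `β` because `α` is missing
        -- at `x`.
        ray-from-x : ∀ i {β} → β ∈ AvailT G k φ (ys i) → Ray G φ x β α (ys i)
        ray-from-x i {β} β∈ with ∃-maximal G prop (α≢β i β∈) (β-missing i β∈)
        ... | s , altPath@((walk , _) , alt) , end-missing
          with nextColour-cases G α β s
             | subst (λ v → Ray G φ v (nextColour G β α s) (nextColour G α β s) (ys i))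
                 (path-ends-at-x i (<-wellFounded i) β∈ s altPath end-missing)
                 (Ray-reverse G s walk alt (stop (β-missing i β∈)))
        ... | inj₁ (p , q) | ray = subst₂ (λ a b → Ray G φ x a b (ys i)) q p ray
        ... | inj₂ (p , q) | ray = contradiction
          (Ray-unique G prop (stop α-missing) (subst₂ (λ a b → Ray G φ x a b (ys i)) q p ray)) (x≢ys i)

      -- Both vertices would be the end of the one ray from `x` that starts with colour `c`.
      AvailT-disjoint : ∀ i j → ys i ≢ ys j → ∀ c → c ∈ AvailT G k φ (ys i) → ¬ c ∈ AvailT G k φ (ys j)
      AvailT-disjoint i j ys≢ c c∈i c∈j = ys≢ (Ray-unique G prop (ray-from-x i c∈i) (ray-from-x j c∈j))

    -- Maximal fans and the fan sum

    module _ (maximal : MaximalFan G k φ e x (suc q) es ys) where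

      -- Otherwise `f` could be appended to the fan, with `j` as the required earlier index.
      fan-closed : ∀ {f c} j → _∈ₑ_ G x f → φ f ≡ just c → c ∈ AvailT G k φ (ys j) → ∃[ i ] (es i ≡ f)
      fan-closed {f} {c} j x∈f eq c∈ with any? (λ i → es i ≟ f)
      ... | yes i,es≡f = i,es≡f
      ... | no f∉ = ⊥-elim (maximal (suc q + 1) es′ ys′ (m<m+n (suc q) (s≤s z≤n)) prefix
        (injective , first , joins , previous))
        where
        y = proj₁ (∈ₑ⇒joins G {e = f} x∈f)

        es′ : Fin (suc q + 1) → E G
        es′ = [ es , (λ _ → f) ]′ ∘ splitAt (suc q)

        ys′ : Fin (suc q + 1) → V G
        ys′ = [ ys , (λ _ → y) ]′ ∘ splitAt (suc q)

        data View : Fin (suc q + 1) → Set where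
          old : ∀ i → View (i ↑ˡ 1)
          new : View (suc q ↑ʳ zero)

        view : ∀ i → View i
        view i with splitAt (suc q) i | join-splitAt (suc q) 1 i
        ... | inj₁ j    | refl = old j
        ... | inj₂ zero | refl = new

        es-old : ∀ i → es′ (i ↑ˡ 1) ≡ es i
        es-old i = cong [ es , (λ _ → f) ]′ (splitAt-↑ˡ (suc q) i 1)

        ys-old : ∀ i → ys′ (i ↑ˡ 1) ≡ ys i
        ys-old i = cong [ ys , (λ _ → y) ]′ (splitAt-↑ˡ (suc q) i 1)

        es-new : es′ (suc q ↑ʳ zero) ≡ f
        es-new = cong [ es , (λ _ → f) ]′ (splitAt-↑ʳ (suc q) 1 zero)

        ys-new : ys′ (suc q ↑ʳ zero) ≡ y
        ys-new = cong [ ys , (λ _ → y) ]′ (splitAt-↑ʳ (suc q) 1 zero)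

        prefix : ∀ (i : Fin (suc q)) (i′ : Fin (suc q + 1)) → toℕ i ≡ toℕ i′ → es′ i′ ≡ es i × ys′ i′ ≡ ys i
        prefix i i′ eq with refl ← toℕ-injective {i = i ↑ˡ 1} {i′} (trans (toℕ-↑ˡ i 1) eq) = es-old i , ys-old i

        injective : ∀ i j → es′ i ≡ es′ j → i ≡ j
        injective i j eq with view i | view j
        ... | old a | old b = cong (_↑ˡ 1) (es-injective a b (trans (sym (es-old a)) (trans eq (es-old b))))
        ... | old a | new   = contradiction (a , trans (sym (es-old a)) (trans eq es-new)) f∉
        ... | new   | old b = contradiction (b , trans (sym (es-old b)) (trans (sym eq) es-new)) f∉
        ... | new   | new   = refl

        first : ∀ i → toℕ i ≡ 0 → es′ i ≡ e
        first i eq with view i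
        ... | old a = trans (es-old a) (proj₁ (proj₂ fan) a (trans (sym (toℕ-↑ˡ a 1)) eq))

        joins : ∀ i → Joins G (es′ i) x (ys′ i)
        joins i with view i
        ... | old a = subst₂ (λ g v → Joins G g x v) (sym (es-old a)) (sym (ys-old a)) (es-joins a)
        ... | new   = subst₂ (λ g v → Joins G g x v) (sym es-new) (sym ys-new) (proj₂ (∈ₑ⇒joins G {e = f} x∈f))

        previous : ∀ i → 0 < toℕ i →
          ∃[ l ] (toℕ l < toℕ i × ∃[ d ] (φ (es′ i) ≡ just d × d ∈ AvailT G k φ (ys′ l)))
        previous i 0<i with view i
        ... | old a = let l , l<a , d , eq′ , d∈ = proj₂ (proj₂ (proj₂ fan)) a (subst (0 <_) (toℕ-↑ˡ a 1) 0<i) in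
          l ↑ˡ 1 , subst₂ _<_ (sym (toℕ-↑ˡ l 1)) (sym (toℕ-↑ˡ a 1)) l<a ,
          d , trans (cong φ (es-old a)) eq′ , subst (λ v → d ∈ AvailT G k φ v) (sym (ys-old l)) d∈
        ... | new   = j ↑ˡ 1 ,
          subst₂ _<_ (sym (toℕ-↑ˡ j 1)) (sym (toℕ-↑ʳ (suc q) zero)) (≤-trans (toℕ<n j) (m≤m+n (suc q) 0)) ,
          c , trans (cong φ es-new) eq , subst (λ v → c ∈ AvailT G k φ v) (sym (ys-old j)) c∈

      -- By `no-common-missing` the colour occurs at `x`, and by `fan-closed` on a fan edge. That
      -- edge is not the uncoloured first one, hence the index `suc i`.
      AvailT⇒fan-colour : ∀ {c} j → c ∈ AvailT G k φ (ys j) → ∃[ i ] (φ (es (suc i)) ≡ just c)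
      AvailT⇒fan-colour {c} j c∈ with ∈-AvailT⁻ G k φ (ys j) c∈ | missing-or-used G φ x c
      ... | r , c≤ , miss-y | inj₁ miss-x = ⊥-elim (no-common-missing j c r miss-x miss-y (inj₂ c≤))
      ... | _ | inj₂ (f , x∈f , eq) with fan-closed j x∈f eq c∈
      ...   | zero  , refl with () ← trans (sym es₀-uncoloured) eq
      AvailT⇒fan-colour {c} j c∈ | _ | inj₂ (f , x∈f , eq) | suc i , refl = i , eq

      -- Some colour is available at `ys zero`; the fan edge that carries it must end elsewhere.
      two-fan-vertices : deg G (ys zero) ≤ k → ∃[ i ] ∃[ j ] (ys i ≢ ys j)
      two-fan-vertices deg≤k with c , c∈ ← ∃-AvailT k φ {e = es zero} deg≤k (ys∈ zero) es₀-uncoloured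
                             with i , eq ← AvailT⇒fan-colour zero c∈ =
        zero , suc i , λ ys≡ → proj₂ (proj₂ (∈-AvailT⁻ G k φ (ys zero) c∈)) (es (suc i))
          (subst (λ v → _∈ₑ_ G v (es (suc i))) (sym ys≡) (ys∈ (suc i))) eq

      -- The available colours at distinct fan vertices are distinct and all occur on the `q`
      -- coloured fan edges, while the multiplicities add up to at least `q + 1`; the uncoloured
      -- edge accounts for the `1`.
      fanSum-positive : (∀ i j → ys i ≢ ys j → ∀ c → c ∈ AvailT G k φ (ys i) → ¬ c ∈ AvailT G k φ (ys j)) →
        + 1 ℤ.≤ fanSum G k φ (suc q) ys
      fanSum-positive disjoint = subst (+ 1 ℤ.≤_) (sym (sum-integer mult′ bound′ (degCol G φ) zs))
        (ℤ.≤-trans (ℤ.≤-reflexive (difference 1 (sumℕ G (map bound′ zs))))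
          (ℤ.+-monoˡ-≤ (ℤ.- + sumℕ G (map bound′ zs)) (ℤ.+≤+ counted)))
        where
        zs = fanVerts G (suc q) ys
        mult′ = fanMult G (suc q) ys
        bound′ = λ z → k ⊓ bound G z
        at = λ z i → _=ᵛ_ G (ys i) z

        difference : ∀ a b → + a ≡ + (a + b) ℤ.- + b
        difference a b = cancel (+ a) (+ b)
          where
          cancel : ∀ a b → a ≡ (a ℤ.+ b) ℤ.- b
          cancel = ℤ-Solver.solve-∀

        =ᵛ⁺ : ∀ {i z} → ys i ≡ z → T (at z i)
        =ᵛ⁺ {i} {z} eq with ys i ≟ z
        ... | yes _ = tt
        ... | no ≢z = ≢z eq

        =ᵛ⁻ : ∀ {i z} → T (at z i) → ys i ≡ z
        =ᵛ⁻ {i} {z} t with ys i ≟ z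
        ... | yes eq = eq

        ∈-zs⁻ : ∀ {z} → z ∈ zs → ∃[ i ] (ys i ≡ z)
        ∈-zs⁻ {z} z∈ with _ , t ← ∈-filter⁻ (T? ∘ λ z → any (at z) (allFin (suc q))) {xs = allFin n} z∈
                     with i , _ , t′ ← find (any⁻ (at z) (allFin (suc q)) t) = i , =ᵛ⁻ t′

        ∈-zs⁺ : ∀ i → ys i ∈ zs
        ∈-zs⁺ i = ∈-filter⁺ (T? ∘ λ z → any (at z) (allFin (suc q)))
          (∈-allFin (ys i)) (any⁺ (at (ys i)) (lose (∈-allFin i) (=ᵛ⁺ refl)))

        available≤q : sumℕ G (map (length ∘ AvailT G k φ) zs) ≤ q
        available≤q = subst₂ _≤_ (length-concatMap G (AvailT G k φ) zs)
          (trans (length-map colour (allFin q)) (length-tabulate id))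
          (Unique-⊆⇒length≤
            (Unique-concatMap (Unique.filter⁺ _ (Unique.allFin⁺ n)) (Unique-AvailT G k φ) disjoint′) sub)
          where
          colour = λ i → colourOf φ (es (suc i))

          disjoint′ : ∀ {z w c} → z ∈ zs → w ∈ zs → z ≢ w → c ∈ AvailT G k φ z → c ∈ AvailT G k φ w → ⊥
          disjoint′ z∈ w∈ z≢w c∈z c∈w with i , refl ← ∈-zs⁻ z∈ | j , refl ← ∈-zs⁻ w∈ = disjoint i j z≢w _ c∈z c∈w

          sub : concatMap (AvailT G k φ) zs ⊆ map colour (allFin q)
          sub {c} c∈ with z , z∈ , c∈z ← concatMap-∈⁻ zs c∈
                     with j , refl ← ∈-zs⁻ z∈
                     with i , eq ← AvailT⇒fan-colour j c∈z =
            subst (_∈ map colour (allFin q)) (cong (fromMaybe 0) eq) (∈-map⁺ colour (∈-allFin i))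

        mult-total : suc q ≤ sumℕ G (map mult′ zs)
        mult-total = subst₂ _≤_ (length-tabulate id) (length-concatMap G indices zs)
          (Unique-⊆⇒length≤ (Unique.allFin⁺ (suc q)) λ {i} _ →
            concatMap-∈⁺ (∈-zs⁺ i) (∈-filter⁺ (T? ∘ at (ys i)) (∈-allFin i) (=ᵛ⁺ refl)))
          where
          indices = λ z → filterᵇ (at z) (allFin (suc q))

        counted : 1 + sumℕ G (map bound′ zs) ≤ sumℕ G (map (λ z → mult′ z + degCol G φ z) zs)
        -- With `q` added on the left, `q + 1` is bounded by the total multiplicity; `sum-exchange`
        -- then leaves the number of available colours, at most `q`, to cancel against.
        counted = +-cancelˡ-≤ q _ _ (≤-trans
          (≤-trans (≤-reflexive (trans (+-suc q _) (+-comm (suc q) (sumℕ G (map bound′ zs)))))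
            (≤-trans (+-monoʳ-≤ (sumℕ G (map bound′ zs)) mult-total)
              (sum-exchange mult′ bound′ (degCol G φ) (length ∘ AvailT G k φ) (bound≤AvailT+degCol k φ) zs)))
          (+-monoˡ-≤ _ available≤q))

theorem3p1 : (k : ℕ) → 2 ≤ k →
    (G : MultiGraph) → (∀ x → deg G x ≤ k) →
    (φ : Colouring G) → ColoursIn G k φ → Proper G φ → Local G φ →
    (∀ C → IsChain G φ C → Vizing G φ C → ¬ Improving G k φ C) →
    (e : E G) → φ e ≡ nothing → (x : V G) → _∈ₑ_ G x e →
    (q : ℕ) → (es : Fin (suc q) → E G) → (ys : Fin (suc q) → V G) →
    IsMultiFan G k φ e x (suc q) es ys →
    (∀ i → ∃[ is ] (Linked _<ᶠ_ (zero ∷ is) × lastIndex G zero is ≡ i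
    × IsChain G φ (map es (zero ∷ is)) × Safe G φ (map es (zero ∷ is))))
    × (∀ i c → c ∈ Avail G k φ x → c ∈ Avail G k φ (ys i)
    → c ≤ bound G x ⊔ bound G (ys i) → ⊥)
    × (∀ i α β → α ∈ AvailT G k φ x → β ∈ AvailT G k φ (ys i) →
    ∀ s → MaxAltPath G φ (ys i) α β s → endpoint G (ys i) s ≡ x)
    × (∀ i j → ys i ≢ ys j → ∀ c → c ∈ AvailT G k φ (ys i) → c ∈ AvailT G k φ (ys j) → ⊥)
    × (MaximalFan G k φ e x (suc q) es ys →
    (∃[ i ] ∃[ j ] (ys i ≢ ys j)) × (+ 1 ℤ.≤ fanSum G k φ (suc q) ys))
theorem3p1 k _ G deg≤k φ col-in prop loc noImp e uncol x x∈e q es ys fan =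
  (λ i → let open FanChain (fanChain i) in
    is , linked , last ,
    subst (IsChain G φ) (sym split) (SafeChain.chain safeChain) ,
    subst (Safe G φ) (sym split) (SafeChain.safe safeChain)) ,
  (λ i c c∈x c∈y c≤ → let r , miss-x = ∈-Avail⁻ G k φ x c∈x
                          _ , miss-y = ∈-Avail⁻ G k φ (ys i) c∈y in
    no-common-missing i c r miss-x miss-y (≤⊔⇒≤⊎≤ c≤)) ,
  (λ i α β α∈ β∈ → maximal-path-ends-at-x α∈ i β∈) ,
  disjoint ,
  (λ maximal → two-fan-vertices maximal (deg≤k (ys zero)) , fanSum-positive maximal disjoint)
  where
  open LocalFan G k φ col-in prop loc noImp e uncol x q es ys fan

  disjoint : ∀ i j → ys i ≢ ys j → ∀ c → c ∈ AvailT G k φ (ys i) → c ∈ AvailT G k φ (ys j) → ⊥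
  -- Any `α` available at `x` will do; one exists because the edge `e` at `x` is uncoloured.
  disjoint = AvailT-disjoint (proj₂ (∃-AvailT G k φ {e = e} (deg≤k x) x∈e uncol))

  ≤⊔⇒≤⊎≤ : ∀ {a b c} → c ≤ a ⊔ b → c ≤ a ⊎ c ≤ b
  ≤⊔⇒≤⊎≤ {a} {b} {c} c≤ =
    [ (λ eq → inj₁ (subst (c ≤_) eq c≤)) , (λ eq → inj₂ (subst (c ≤_) eq c≤)) ]′ (⊔-sel a b)
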